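{- For a nonnegative integer $n$, $$\sum_{p+q=2n+1}(p+1)\zeta^\star(\{1\}^{p+1},q+2)-\sum_{p+q=2n+1}G_{q+2}(1,p)=\binom{2n+4}{3}\zeta(2n+4)+\sum_{j=1}^n(-1)^j\sum_{|c_j|=2n+1-2j}\zeta(c_{j0}+3,c_{j1}+2,\ldots,c_{jj}+2)\,W(c_j),$$ where $W(c_j)=W(c_{j0},c_{j1},\ldots,c_{jj})=\binom{c_{j0}+3}{3}(c_{j1}+1)\cdots(c_{jj}+1)$.
   Context: $\zeta(\alpha_1,\ldots,\alpha_k)=\sum_{1\le k_1<\cdots<k_k}k_1^{ -\alpha_1}\cdots k_k^{ -\alpha_k}$; $\zeta^\star(\alpha_1,\ldots,\alpha_k)=\sum_{1\le k_1\le\cdots\le k_k}k_1^{ -\alpha_1}\cdots k_k^{ -\alpha_k}$; $\{a\}^k$ denotes $k$ repetitions of $a$. The sums over $p+q=2n+1$ are over nonnegative integers $p,q$. For each $j$, $\sum_{|c_j|=2n+1-2j}$ is over all $(j+1)$-tuples $c_j=(c_{j0},c_{j1},\ldots,c_{jj})$ of nonnegative integers with $c_{j0}+c_{j1}+\cdots+c_{jj}=2n+1-2j$. For nonnegative integers $n,p,q$, $$G_{n+2}(p,q)=\sum_{1\le k_1<\cdots<k_{p+1}}\frac{1}{k_1\cdots k_p\,k_{p+1}^{n+2}}\sum_{1\le \ell_1\le\cdots\le\ell_q\le k_{p+1}}\frac{1}{\ell_1\cdots\ell_q}.$$ -}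

module Defs where

open import Data.Integer as ℤ using (ℤ; +_)
import Data.Integer.Properties as ℤ
open import Data.List using (List; []; _∷_; [_]; _++_; _∷ʳ_; map; foldr; concatMap; applyUpTo; replicate; reverse; length)
open import Data.List.Properties using (unfold-reverse; length-replicate)
open import Data.List.Relation.Unary.All using (All; []; _∷_)
open import Data.List.Relation.Unary.All.Properties using (∷ʳ⁺; replicate⁺)
open import Data.Nat as ℕ using (ℕ; zero; suc; pred)
open import Data.Nat.Combinatorics using (_C_)
open import Data.Nat.ListAction using (product)
import Data.Nat.Properties as ℕ
open import Data.Product using (∃; ∃₂; _×_; _,_)
open import Data.Rational as ℚ using (ℚ; 0ℚ; 1ℚ; ½; _+_; _*_; _-_; -_; _/_; ∣_∣; _≤_; _<_)
import Data.Rational.Properties as ℚ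
open import Data.Rational.Solver using (module +-*-Solver)
import Data.Rational.Unnormalised as ℚᵘ
import Data.Rational.Unnormalised.Properties as ℚᵘ
open import Data.Sum using (_⊎_; inj₁; inj₂)
open import Data.Vec using (Vec; []; _∷_; toList)
open import Function using (id)
open import Relation.Binary.PropositionalEquality using (_≡_; refl; sym; trans; cong; cong₂; subst; subst₂)
open import Relation.Nullary using (contradiction)

open ℚ.≤-Reasoning

ι : ℕ → ℚ
ι n = + n / 1

/-* : ∀ i a j b → (i / suc a) * (j / suc b) ≡ (i ℤ.* j) / (suc a ℕ.* suc b)
/-* i a j b = ℚ.toℚᵘ-injective (ℚᵘ.≃-trans (ℚ.toℚᵘ-homo-* (i / suc a) (j / suc b))
  (ℚᵘ.≃-trans (ℚᵘ.*-cong (ℚ.toℚᵘ-fromℚᵘ (ℚᵘ.mkℚᵘ i a)) (ℚ.toℚᵘ-fromℚᵘ (ℚᵘ.mkℚᵘ j b)))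
    (ℚᵘ.≃-sym (ℚ.toℚᵘ-fromℚᵘ (ℚᵘ.mkℚᵘ i a ℚᵘ.* ℚᵘ.mkℚᵘ j b)))))

/-≡ : ∀ i a j b → i ℤ.* + suc b ≡ j ℤ.* + suc a → i / suc a ≡ j / suc b
/-≡ i a j b eq = ℚ.fromℚᵘ-cong {ℚᵘ.mkℚᵘ i a} {ℚᵘ.mkℚᵘ j b} (ℚᵘ.*≡* eq)

/-≤ : ∀ i a j b → i ℤ.* + suc b ℤ.≤ j ℤ.* + suc a → i / suc a ≤ j / suc b
/-≤ i a j b le = ℚ.toℚᵘ-cancel-≤
  (ℚᵘ.≤-trans (ℚᵘ.≤-reflexive (ℚ.toℚᵘ-fromℚᵘ (ℚᵘ.mkℚᵘ i a)))
    (ℚᵘ.≤-trans (ℚᵘ.*≤* le) (ℚᵘ.≤-reflexive (ℚᵘ.≃-sym (ℚ.toℚᵘ-fromℚᵘ (ℚᵘ.mkℚᵘ j b))))))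

ι-+ : ∀ m n → ι (m ℕ.+ n) ≡ ι m + ι n
ι-+ m n = ℚ.toℚᵘ-injective (ℚᵘ.≃-trans (ℚ.toℚᵘ-fromℚᵘ (ℚᵘ.mkℚᵘ (+ (m ℕ.+ n)) 0))
  (ℚᵘ.≃-trans (ℚᵘ.*≡* eq)
  (ℚᵘ.≃-sym (ℚᵘ.≃-trans (ℚ.toℚᵘ-homo-+ (ι m) (ι n))
    (ℚᵘ.+-cong (ℚ.toℚᵘ-fromℚᵘ (ℚᵘ.mkℚᵘ (+ m) 0)) (ℚ.toℚᵘ-fromℚᵘ (ℚᵘ.mkℚᵘ (+ n) 0)))))))
  where
  eq : + (m ℕ.+ n) ℤ.* + 1 ≡ (+ m ℤ.* + 1 ℤ.+ + n ℤ.* + 1) ℤ.* + 1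
  eq rewrite ℤ.*-identityʳ (+ m) | ℤ.*-identityʳ (+ n) = refl

ι-* : ∀ m n → ι (m ℕ.* n) ≡ ι m * ι n
ι-* m n = trans (cong (_/ 1) (ℤ.pos-* m n)) (sym (/-* (+ m) 0 (+ n) 0))

ι-mono : ∀ m n → m ℕ.≤ n → ι m ≤ ι n
ι-mono m n le = /-≤ (+ m) 0 (+ n) 0 (ℤ.*-monoʳ-≤-nonNeg (+ 1) (ℤ.+≤+ le))

0≤ι : ∀ n → 0ℚ ≤ ι n
0≤ι n = ι-mono 0 n ℕ.z≤n

u : ℕ → ℚ
u i = + 1 / suc i

u-inv : ∀ i → ι (suc i) * u i ≡ 1ℚ
u-inv i = trans (/-* (+ suc i) 0 (+ 1) i)
  (/-≡ (+ suc i ℤ.* + 1) (i ℕ.+ 0) (+ 1) 0 eq)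
  where
  eq : + suc i ℤ.* + 1 ℤ.* + 1 ≡ + 1 ℤ.* + suc (i ℕ.+ 0)
  eq rewrite ℤ.*-identityʳ (+ suc i ℤ.* + 1) | ℤ.*-identityʳ (+ suc i)
           | ℤ.*-identityˡ (+ suc (i ℕ.+ 0)) | ℕ.+-identityʳ i = refl

0≤u : ∀ i → 0ℚ ≤ u i
0≤u i = /-≤ (+ 0) 0 (+ 1) i (subst₂ ℤ._≤_ (sym (ℤ.*-zeroˡ (+ suc i))) (sym (ℤ.*-identityˡ (+ 1))) (ℤ.+≤+ ℕ.z≤n))

0<u : ∀ i → 0ℚ < u i
0<u i = ℚ.≰⇒> λ le → contradiction
  (subst₂ _≤_ (u-inv i) (ℚ.*-zeroʳ (ι (suc i)))
    (ℚ.*-monoˡ-≤-nonNeg (ι (suc i)) {{ℚ.nonNegative (0≤ι (suc i))}} le))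
  (λ { (ℚ.*≤* (ℤ.+≤+ ())) })

u-anti : ∀ {i j} → i ℕ.≤ j → u j ≤ u i
u-anti {i} {j} le = /-≤ (+ 1) j (+ 1) i (ℤ.*-monoˡ-≤-nonNeg (+ 1) (ℤ.+≤+ (ℕ.s≤s le)))

*-monoˡ : ∀ {r p q} → 0ℚ ≤ r → p ≤ q → r * p ≤ r * q
*-monoˡ {r} h = ℚ.*-monoˡ-≤-nonNeg r {{ℚ.nonNegative h}}

*-monoʳ : ∀ {r p q} → 0ℚ ≤ r → p ≤ q → p * r ≤ q * r
*-monoʳ {r} h = ℚ.*-monoʳ-≤-nonNeg r {{ℚ.nonNegative h}}

*-mono : ∀ {p q r s} → 0ℚ ≤ r → 0ℚ ≤ q → p ≤ q → r ≤ s → p * r ≤ q * s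
*-mono 0≤r 0≤q p≤q r≤s = ℚ.≤-trans (*-monoʳ 0≤r p≤q) (*-monoˡ 0≤q r≤s)

0≤* : ∀ {p q} → 0ℚ ≤ p → 0ℚ ≤ q → 0ℚ ≤ p * q
0≤* {p} {q} hp hq = subst (_≤ p * q) (ℚ.*-zeroʳ p) (*-monoˡ hp hq)

0≤+ : ∀ {p q} → 0ℚ ≤ p → 0ℚ ≤ q → 0ℚ ≤ p + q
0≤+ hp hq = ℚ.+-mono-≤ hp hq

p≤p+q : ∀ {p q} → 0ℚ ≤ q → p ≤ p + q
p≤p+q {p} {q} h = subst (_≤ p + q) (ℚ.+-identityʳ p) (ℚ.+-monoʳ-≤ p h)

0≤1 : 0ℚ ≤ 1ℚ
0≤1 = 0≤ι 1

0<1 : 0ℚ < 1ℚ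
0<1 = ℚ.*<* (ℤ.+<+ (ℕ.s≤s ℕ.z≤n))

p≤q⇒0≤q-p : ∀ {p q} → p ≤ q → 0ℚ ≤ q - p
p≤q⇒0≤q-p {p} {q} h = subst (_≤ q - p) (ℚ.+-inverseʳ p) (ℚ.+-monoˡ-≤ (- p) h)

p≤q+r⇒p-q≤r : ∀ {p q r} → p ≤ q + r → p - q ≤ r
p≤q+r⇒p-q≤r {p} {q} {r} h = subst (p - q ≤_)
  (solve 2 (λ q r → q :+ r :- q := r) refl q r) (ℚ.+-monoˡ-≤ (- q) h)
  where open +-*-Solver

∣-∣-swap : ∀ p q → ∣ p - q ∣ ≡ ∣ q - p ∣
∣-∣-swap p q = trans (cong ∣_∣ (solve 2 (λ p q → p :- q := :- (q :- p)) refl p q)) (ℚ.∣-p∣≡∣p∣ (q - p))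
  where open +-*-Solver

_^ℚ_ : ℚ → ℕ → ℚ
q ^ℚ zero  = 1ℚ
q ^ℚ suc r = q * q ^ℚ r

0≤^ : ∀ {q} → 0ℚ ≤ q → ∀ r → 0ℚ ≤ q ^ℚ r
0≤^ h zero    = 0≤1
0≤^ h (suc r) = 0≤* h (0≤^ h r)

^-mono : ∀ {p q} → 0ℚ ≤ p → p ≤ q → ∀ r → p ^ℚ r ≤ q ^ℚ r
^-mono 0≤p p≤q zero    = ℚ.≤-refl
^-mono 0≤p p≤q (suc r) = *-mono (0≤^ 0≤p r) (ℚ.≤-trans 0≤p p≤q) p≤q (^-mono 0≤p p≤q r)

^-+ : ∀ q r s → q ^ℚ (r ℕ.+ s) ≡ q ^ℚ r * q ^ℚ s
^-+ q zero    s = sym (ℚ.*-identityˡ (q ^ℚ s))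
^-+ q (suc r) s = trans (cong (q *_) (^-+ q r s)) (sym (ℚ.*-assoc q (q ^ℚ r) (q ^ℚ s)))

archimedean : ∀ q {ε} → 0ℚ < ε → ∃ λ n → q < ε * ι (suc n)
archimedean q {ε} 0<ε = d ℕ.* suc a , (begin-strict
  q                       ≤⟨ q≤ ⟩
  ι a                     <⟨ ιa<ιsa ⟩
  ι (suc a)               ≡⟨ ℚ.*-identityˡ (ι (suc a)) ⟨
  1ℚ * ι (suc a)          ≤⟨ *-monoʳ (0≤ι (suc a)) 1≤ ⟩
  ε * ι d * ι (suc a)     ≡⟨ trans (ℚ.*-assoc ε (ι d) (ι (suc a))) (cong (ε *_) (sym (ι-* d (suc a)))) ⟩
  ε * ι (d ℕ.* suc a)     ≤⟨ *-monoˡ (ℚ.<⇒≤ 0<ε) (ι-mono (d ℕ.* suc a) _ (ℕ.n≤1+n (d ℕ.* suc a))) ⟩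
  ε * ι (suc (d ℕ.* suc a)) ∎)
  where
  a = ℤ.∣ ℚ.↥ q ∣
  d = ℚ.↧ₙ ε
  i≤∣i∣ : ∀ i → i ℤ.≤ + ℤ.∣ i ∣
  i≤∣i∣ (+ n)      = ℤ.≤-refl
  i≤∣i∣ ℤ.-[1+ n ] = ℤ.-≤+
  q≤ : q ≤ ι a
  q≤ = subst (_≤ ι a) (ℚ.↥p/↧p≡p q)
    (/-≤ (ℚ.↥ q) (ℚ.ℚ.denominator-1 q) (+ a) 0
      (subst (ℤ._≤ + a ℤ.* ℚ.↧ q) (sym (ℤ.*-identityʳ (ℚ.↥ q)))
        (ℤ.≤-trans (i≤∣i∣ (ℚ.↥ q))
          (subst (ℤ._≤ + a ℤ.* ℚ.↧ q) (ℤ.*-identityʳ (+ a))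
            (ℤ.*-monoˡ-≤-nonNeg (+ a) (ℤ.+≤+ (ℕ.s≤s ℕ.z≤n)))))))
  ιa<ιsa : ι a < ι (suc a)
  ιa<ιsa = subst₂ _<_ (ℚ.+-identityˡ (ι a)) (sym (ι-+ 1 a)) (ℚ.+-monoˡ-< (ι a) 0<1)
  0<↥ : + 1 ℤ.≤ ℚ.↥ ε
  0<↥ = ℤ.i<j⇒suc[i]≤j (subst₂ ℤ._<_ (ℤ.*-zeroˡ (ℚ.↧ ε)) (ℤ.*-identityʳ (ℚ.↥ ε)) (ℚ.drop-*<* 0<ε))
  uε : u (ℚ.ℚ.denominator-1 ε) ≤ ε
  uε = subst (u (ℚ.ℚ.denominator-1 ε) ≤_) (ℚ.↥p/↧p≡p ε)
    (/-≤ (+ 1) _ (ℚ.↥ ε) (ℚ.ℚ.denominator-1 ε) (ℤ.*-monoʳ-≤-nonNeg (ℚ.↧ ε) 0<↥))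
  1≤ : 1ℚ ≤ ε * ι d
  1≤ = subst (_≤ ε * ι d) (trans (ℚ.*-comm (u (ℚ.ℚ.denominator-1 ε)) (ι d)) (u-inv (ℚ.ℚ.denominator-1 ε))) (*-monoʳ (0≤ι d) uε)

-- Real numbers are Cauchy sequences of rationals; equality of reals is _≈_,
-- i.e. the difference of the two sequences tends to 0.

IsCauchy : (ℕ → ℚ) → Set
IsCauchy s = ∀ ε → 0ℚ < ε → ∃ λ N → ∀ m n → N ℕ.≤ m → N ℕ.≤ n → ∣ s m - s n ∣ < ε

record ℝ : Set where
  constructor mkℝ
  field
    seq    : ℕ → ℚ
    cauchy : IsCauchy seq
open ℝ public

infix 4 _≈_
_≈_ : ℝ → ℝ → Set
x ≈ y = ∀ ε → 0ℚ < ε → ∃ λ N → ∀ n → N ℕ.≤ n → ∣ seq x n - seq y n ∣ < ε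

0ℝ : ℝ
0ℝ = mkℝ (λ _ → 0ℚ) λ ε 0<ε → 0 , λ _ _ _ _ → 0<ε

infixl 6 _+ᵣ_ _-ᵣ_
infixr 7 _·_

abstract
  +-cauchy : ∀ {s t} → IsCauchy s → IsCauchy t → IsCauchy (λ n → s n + t n)
  +-cauchy {s} {t} hs ht ε 0<ε =
    let 0<½ε = ℚ.*-monoʳ-<-pos ½ 0<ε
        (M , hM) = hs (½ * ε) 0<½ε
        (N , hN) = ht (½ * ε) 0<½ε
    in M ℕ.⊔ N , λ m n hm hn → begin-strict
      ∣ s m + t m - (s n + t n) ∣
        ≡⟨ cong ∣_∣ (solve 4 (λ a b c d → a :+ b :- (c :+ d) := (a :- c) :+ (b :- d)) refl (s m) (t m) (s n) (t n)) ⟩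
      ∣ (s m - s n) + (t m - t n) ∣
        ≤⟨ ℚ.∣p+q∣≤∣p∣+∣q∣ (s m - s n) (t m - t n) ⟩
      ∣ s m - s n ∣ + ∣ t m - t n ∣
        <⟨ ℚ.+-mono-< (hM m n (ℕ.m⊔n≤o⇒m≤o M N hm) (ℕ.m⊔n≤o⇒m≤o M N hn))
                      (hN m n (ℕ.m⊔n≤o⇒n≤o M N hm) (ℕ.m⊔n≤o⇒n≤o M N hn)) ⟩
      ½ * ε + ½ * ε ≡⟨ solve 1 (λ e → con ½ :* e :+ con ½ :* e := e) refl ε ⟩
      ε ∎
    where open +-*-Solver

  *-cauchy : ∀ q {s} → IsCauchy s → IsCauchy (λ n → q * s n)
  *-cauchy q {s} hs ε 0<ε =
    let (k , q<) = archimedean ∣ q ∣ 0<1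
        0<δ = subst (_< ε * u k) (ℚ.*-zeroʳ ε) (ℚ.*-monoʳ-<-pos ε {{ℚ.positive 0<ε}} (0<u k))
        (N , h) = hs (ε * u k) 0<δ
    in N , λ m n hm hn → begin-strict
      ∣ q * s m - q * s n ∣
        ≡⟨ cong ∣_∣ (solve 3 (λ q a b → q :* a :- q :* b := q :* (a :- b)) refl q (s m) (s n)) ⟩
      ∣ q * (s m - s n) ∣ ≡⟨ ℚ.∣p*q∣≡∣p∣*∣q∣ q (s m - s n) ⟩
      ∣ q ∣ * ∣ s m - s n ∣
        ≤⟨ *-monoˡ (ℚ.0≤∣p∣ q) (ℚ.<⇒≤ (h m n hm hn)) ⟩
      ∣ q ∣ * (ε * u k)
        <⟨ ℚ.*-monoˡ-<-pos (ε * u k) {{ℚ.positive 0<δ}} q< ⟩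
      1ℚ * ι (suc k) * (ε * u k)
        ≡⟨ solve 3 (λ i e u → con 1ℚ :* i :* (e :* u) := e :* (i :* u)) refl (ι (suc k)) ε (u k) ⟩
      ε * (ι (suc k) * u k) ≡⟨ trans (cong (ε *_) (u-inv k)) (ℚ.*-identityʳ ε) ⟩
      ε ∎
    where open +-*-Solver

_+ᵣ_ : ℝ → ℝ → ℝ
x +ᵣ y = mkℝ (λ n → seq x n + seq y n) (+-cauchy {seq x} {seq y} (cauchy x) (cauchy y))

_·_ : ℤ → ℝ → ℝ
z · x = mkℝ (λ n → z / 1 * seq x n) (*-cauchy (z / 1) {seq x} (cauchy x))

_-ᵣ_ : ℝ → ℝ → ℝ
x -ᵣ y = x +ᵣ ℤ.-1ℤ · y

∑ : ∀ {A : Set} → List A → (A → ℝ) → ℝ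
∑ xs f = foldr (λ a s → f a +ᵣ s) 0ℝ xs

-- Convergence criterion used for every series below: a series with terms 0 ≤ f k ≤ H_k^r / k², H_k the k-th
-- harmonic number, converges.  The remainders are controlled by
-- e i = ∏_{j≤i} 2j/(2j+1), which decreases to 0.

sumTo : (ℕ → ℚ) → ℕ → ℚ
sumTo f zero    = 0ℚ
sumTo f (suc N) = sumTo f N + f (suc N)

v : ℕ → ℚ
v i = u (suc (suc (i ℕ.+ i)))

0≤v : ∀ i → 0ℚ ≤ v i
0≤v i = 0≤u (suc (suc (i ℕ.+ i)))

D : ℕ → ℚ
D i = (ι 3 + (ι i + ι i)) * v i

D≡1 : ∀ i → D i ≡ 1ℚ
D≡1 i = trans (cong (_* v i) (sym (trans (ι-+ 3 (i ℕ.+ i)) (cong (λ a → ι 3 + a) (ι-+ i i))))) (u-inv (suc (suc (i ℕ.+ i))))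

kill : ∀ i p q → p + q * (1ℚ - D i) ≡ p
kill i p q = trans (cong (λ d → p + q * (1ℚ - d)) (D≡1 i))
  (trans (cong (λ a → p + a) (ℚ.*-zeroʳ q)) (ℚ.+-identityʳ p))

e : ℕ → ℚ
e zero    = 1ℚ
e (suc i) = e i * (1ℚ - v i)

y : ℕ → ℚ
y i = ι (suc i) * e i

0≤e : ∀ i → 0ℚ ≤ e i
0≤e zero    = 0≤1
0≤e (suc i) = 0≤* (0≤e i) (p≤q⇒0≤q-p (u-anti {0} {suc (suc (i ℕ.+ i))} ℕ.z≤n))

0≤y : ∀ i → 0ℚ ≤ y i
0≤y i = 0≤* (0≤ι (suc i)) (0≤e i)

e-step : ∀ i → e (suc i) + v i * e i ≡ e i
e-step i = solve 2 (λ e v → e :* (con 1ℚ :- v) :+ v :* e := e) refl (e i) (v i)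
  where open +-*-Solver

y-step : ∀ i → y (suc i) ≡ y i + v i * y i
y-step i = trans
  (cong (_* (e i * (1ℚ - v i))) (ι-+ 2 i))
  (trans (solve 3 (λ e v x →
      (con (ι 2) :+ x) :* (e :* (con 1ℚ :- v)) :=
      ((con 1ℚ :+ x) :* e :+ v :* ((con 1ℚ :+ x) :* e))
        :+ e :* (con 1ℚ :- (con (ι 3) :+ (x :+ x)) :* v)) refl (e i) (v i) (ι i))
  (trans (kill i _ (e i))
    (cong (λ a → a * e i + v i * (a * e i)) (sym (ι-+ 1 i)))))
  where open +-*-Solver

e≡2vy : ∀ i → e (suc i) ≡ ι 2 * (v i * y i)
e≡2vy i = trans
  (solve 3 (λ e v x →
      e :* (con 1ℚ :- v) :=
      con (ι 2) :* (v :* ((con 1ℚ :+ x) :* e)) :+ e :* (con 1ℚ :- (con (ι 3) :+ (x :+ x)) :* v)) refl (e i) (v i) (ι i))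
  (trans (kill i _ (e i)) (cong (λ a → ι 2 * (v i * (a * e i))) (sym (ι-+ 1 i))))
  where open +-*-Solver

e²-step : ∀ i → e (suc i) * e (suc i) * ι (suc (suc i)) ≤ e i * e i * ι (suc i)
e²-step i = begin
  e (suc i) * e (suc i) * ι (suc (suc i))
    ≡⟨ cong (e (suc i) * e (suc i) *_) (ι-+ 2 i) ⟩
  e (suc i) * e (suc i) * (ι 2 + ι i)
    ≤⟨ p≤p+q (0≤* (0≤* (0≤* (0≤e i) (0≤e i)) (0≤+ 0≤1 (0≤ι i))) (0≤* (0≤v i) (0≤v i))) ⟩
  e (suc i) * e (suc i) * (ι 2 + ι i) + e i * e i * (1ℚ + ι i) * (v i * v i)
    ≡⟨ solve 3 (λ e v x →
         (e :* (con 1ℚ :- v)) :* (e :* (con 1ℚ :- v)) :* (con (ι 2) :+ x) :+ e :* e :* (con 1ℚ :+ x) :* (v :* v) :=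
         e :* e :* (con 1ℚ :+ x) :+ e :* e :* (con 1ℚ :- v) :* (con 1ℚ :- (con (ι 3) :+ (x :+ x)) :* v))
         refl (e i) (v i) (ι i) ⟩
  e i * e i * (1ℚ + ι i) + e i * e i * (1ℚ - v i) * (1ℚ - D i)
    ≡⟨ kill i _ (e i * e i * (1ℚ - v i)) ⟩
  e i * e i * (1ℚ + ι i) ≡⟨ cong (e i * e i *_) (ι-+ 1 i) ⟨
  e i * e i * ι (suc i) ∎
  where open +-*-Solver

e²≤ : ∀ i → e i * e i * ι (suc i) ≤ 1ℚ
e²≤ zero    = ℚ.≤-refl
e²≤ (suc i) = ℚ.≤-trans (e²-step i) (e²≤ i)

u≤3v : ∀ i → u i ≤ ι 3 * v i
u≤3v i = begin
  u i ≡⟨ trans (cong (u i *_) (D≡1 i)) (ℚ.*-identityʳ (u i)) ⟨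
  u i * D i ≤⟨ p≤p+q (0≤* (0≤u i) (0≤* (0≤ι i) (0≤v i))) ⟩
  u i * D i + u i * (ι i * v i)
    ≡⟨ solve 3 (λ u v x → u :* ((con (ι 3) :+ (x :+ x)) :* v) :+ u :* (x :* v)
                := con (ι 3) :* v :* ((con 1ℚ :+ x) :* u)) refl (u i) (v i) (ι i) ⟩
  ι 3 * v i * ((1ℚ + ι i) * u i)
    ≡⟨ cong (ι 3 * v i *_) (trans (cong (_* u i) (sym (ι-+ 1 i))) (u-inv i)) ⟩
  ι 3 * v i * 1ℚ ≡⟨ ℚ.*-identityʳ _ ⟩
  ι 3 * v i ∎
  where open +-*-Solver

u*y : ∀ i → u i * y i ≡ e i
u*y i = trans (solve 3 (λ u n e → u :* (n :* e) := n :* u :* e) refl (u i) (ι (suc i)) (e i))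
  (trans (cong (_* e i) (u-inv i)) (ℚ.*-identityˡ (e i)))
  where open +-*-Solver

H : ℕ → ℚ
H zero    = 0ℚ
H (suc i) = H i + u i

0≤H : ∀ k → 0ℚ ≤ H k
0≤H zero    = ℚ.≤-refl
0≤H (suc k) = 0≤+ (0≤H k) (0≤u k)

bd : ℕ → ℕ
bd zero    = 1
bd (suc r) = 2 ℕ.* suc r ℕ.* bd r

1≤bd : ∀ r → 1 ℕ.≤ bd r
1≤bd zero    = ℕ.≤-refl
1≤bd (suc r) = ℕ.*-mono-≤ {1} {2 ℕ.* suc r} (ℕ.s≤s ℕ.z≤n) (1≤bd r)

^-step : ∀ h w → 0ℚ ≤ h → 0ℚ ≤ w → ∀ r →
  (h + w) ^ℚ suc r ≤ h ^ℚ suc r + ι (suc r) * w * (h + w) ^ℚ r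
^-step h w 0≤h 0≤w zero = ℚ.≤-reflexive
  (solve 2 (λ h w → (h :+ w) :* con 1ℚ := h :* con 1ℚ :+ con 1ℚ :* w :* con 1ℚ) refl h w)
  where open +-*-Solver
^-step h w 0≤h 0≤w (suc r) = begin
  (h + w) * (h + w) ^ℚ suc r
    ≤⟨ *-monoˡ (0≤+ 0≤h 0≤w) (^-step h w 0≤h 0≤w r) ⟩
  (h + w) * (h ^ℚ suc r + ι (suc r) * w * (h + w) ^ℚ r)
    ≡⟨ solve 5 (λ h w a n b → (h :+ w) :* (a :+ n :* w :* b) := (h :* a :+ n :* w :* ((h :+ w) :* b)) :+ w :* a)
         refl h w (h ^ℚ suc r) (ι (suc r)) ((h + w) ^ℚ r) ⟩
  h * h ^ℚ suc r + ι (suc r) * w * (h + w) ^ℚ suc r + w * h ^ℚ suc r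
    ≤⟨ ℚ.+-monoʳ-≤ (h * h ^ℚ suc r + ι (suc r) * w * (h + w) ^ℚ suc r)
        (*-monoˡ 0≤w (^-mono 0≤h (p≤p+q 0≤w) (suc r))) ⟩
  h * h ^ℚ suc r + ι (suc r) * w * (h + w) ^ℚ suc r + w * (h + w) ^ℚ suc r
    ≡⟨ solve 4 (λ a n w b → a :+ n :* w :* b :+ w :* b := a :+ (con 1ℚ :+ n) :* w :* b)
         refl (h * h ^ℚ suc r) (ι (suc r)) w ((h + w) ^ℚ suc r) ⟩
  h * h ^ℚ suc r + (1ℚ + ι (suc r)) * w * (h + w) ^ℚ suc r
    ≡⟨ cong (λ a → h * h ^ℚ suc r + a * w * (h + w) ^ℚ suc r) (ι-+ 1 (suc r)) ⟨
  h * h ^ℚ suc r + ι (suc (suc r)) * w * (h + w) ^ℚ suc r ∎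
  where open +-*-Solver

1^ : ∀ r → 1ℚ ^ℚ r ≡ 1ℚ
1^ zero    = refl
1^ (suc r) = trans (ℚ.*-identityˡ (1ℚ ^ℚ r)) (1^ r)

H^≤ : ∀ r i → H (suc i) ^ℚ r ≤ ι (bd r) * y i
H^≤ r zero = begin
  1ℚ ^ℚ r         ≡⟨ 1^ r ⟩
  1ℚ              ≤⟨ ι-mono 1 (bd r) (1≤bd r) ⟩
  ι (bd r)        ≡⟨ ℚ.*-identityʳ (ι (bd r)) ⟨
  ι (bd r) * 1ℚ   ∎
H^≤ zero (suc i) = begin
  1ℚ              ≤⟨ H^≤ zero i ⟩
  1ℚ * y i        ≤⟨ *-monoˡ 0≤1 (p≤p+q {y i} {v i * y i} (0≤* (0≤v i) (0≤y i))) ⟩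
  1ℚ * (y i + v i * y i) ≡⟨ cong (1ℚ *_) (y-step i) ⟨
  1ℚ * y (suc i) ∎
H^≤ (suc r) (suc i) = begin
  H (suc (suc i)) ^ℚ suc r
    ≤⟨ ^-step (H (suc i)) w (0≤H (suc i)) (0≤u (suc i)) r ⟩
  H (suc i) ^ℚ suc r + ι (suc r) * w * H (suc (suc i)) ^ℚ r
    ≤⟨ ℚ.+-mono-≤ (H^≤ (suc r) i) (*-monoˡ (0≤* (0≤ι (suc r)) (0≤u (suc i))) (H^≤ r (suc i))) ⟩
  c' * y i + ι (suc r) * w * (c * y (suc i))
    ≡⟨ cong (λ a → c' * y i + a) (solve 4 (λ n w c y → n :* w :* (c :* y) := n :* c :* (w :* y)) refl (ι (suc r)) w c (y (suc i))) ⟩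
  c' * y i + ι (suc r) * c * (w * y (suc i))
    ≡⟨ cong (λ a → c' * y i + ι (suc r) * c * a) (trans (u*y (suc i)) (e≡2vy i)) ⟩
  c' * y i + ι (suc r) * c * (ι 2 * (v i * y i))
    ≡⟨ cong (λ a → a * y i + ι (suc r) * c * (ι 2 * (v i * y i))) c'≡ ⟩
  ι 2 * ι (suc r) * c * y i + ι (suc r) * c * (ι 2 * (v i * y i))
    ≡⟨ solve 4 (λ n c v y → con (ι 2) :* n :* c :* y :+ n :* c :* (con (ι 2) :* (v :* y))
                 := con (ι 2) :* n :* c :* (y :+ v :* y)) refl (ι (suc r)) c (v i) (y i) ⟩
  ι 2 * ι (suc r) * c * (y i + v i * y i)
    ≡⟨ cong₂ _*_ c'≡ (y-step i) ⟨
  c' * y (suc i) ∎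
  where
  open +-*-Solver
  w  = u (suc i)
  c  = ι (bd r)
  c' = ι (bd (suc r))
  c'≡ : c' ≡ ι 2 * ι (suc r) * c
  c'≡ = trans (ι-* (2 ℕ.* suc r) (bd r)) (cong (_* c) (ι-* 2 (suc r)))

antitone : (a : ℕ → ℚ) → (∀ i → a (suc i) ≤ a i) → ∀ {m n} → m ℕ.≤ n → a n ≤ a m
antitone a h {m} m≤n = go (ℕ.≤⇒≤′ m≤n)
  where
  go : ∀ {n} → m ℕ.≤′ n → a n ≤ a m
  go (ℕ.≤′-reflexive refl) = ℚ.≤-refl
  go (ℕ.≤′-step {n} q)     = ℚ.≤-trans (h n) (go q)

e-anti : ∀ {m n} → m ℕ.≤ n → e n ≤ e m
e-anti = antitone e λ i → subst (e (suc i) ≤_) (e-step i) (p≤p+q (0≤* (0≤v i) (0≤e i)))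

e→0 : ∀ K → 0ℚ ≤ K → ∀ ε → 0ℚ < ε → ∃ λ n → K * e n < ε
e→0 K 0≤K ε 0<ε =
  let 0<ε² = subst (_< ε * ε) (ℚ.*-zeroʳ ε) (ℚ.*-monoʳ-<-pos ε {{ℚ.positive 0<ε}} 0<ε)
      (n , K²<) = archimedean (K * K) 0<ε²
  in n , ℚ.≰⇒> λ ε≤ → ℚ.<-irrefl refl (begin-strict
    K * K <⟨ K²< ⟩
    ε * ε * ι (suc n)
      ≤⟨ *-monoʳ (0≤ι (suc n)) (*-mono (ℚ.<⇒≤ 0<ε) (0≤* 0≤K (0≤e n)) ε≤ ε≤) ⟩
    (K * e n) * (K * e n) * ι (suc n)
      ≡⟨ solve 3 (λ K e n → (K :* e) :* (K :* e) :* n := K :* K :* (e :* e :* n)) refl K (e n) (ι (suc n)) ⟩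
    K * K * (e n * e n * ι (suc n)) ≤⟨ *-monoˡ (0≤* 0≤K 0≤K) (e²≤ n) ⟩
    K * K * 1ℚ ≡⟨ ℚ.*-identityʳ (K * K) ⟩
    K * K ∎)
  where open +-*-Solver

module Series (f : ℕ → ℚ) (r : ℕ) (0≤f : ∀ i → 0ℚ ≤ f (suc i))
              (f≤ : ∀ i → f (suc i) ≤ u i * u i * H (suc i) ^ℚ r) where

  K : ℚ
  K = ι 3 * ι (bd r)

  0≤K : 0ℚ ≤ K
  0≤K = 0≤* (0≤ι 3) (0≤ι (bd r))

  f≤′ : ∀ i → f (suc i) ≤ K * (v i * e i)
  f≤′ i = begin
    f (suc i) ≤⟨ f≤ i ⟩
    u i * u i * H (suc i) ^ℚ r ≤⟨ *-monoˡ (0≤* (0≤u i) (0≤u i)) (H^≤ r i) ⟩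
    u i * u i * (ι (bd r) * y i)
      ≡⟨ solve 3 (λ u c y → u :* u :* (c :* y) := u :* (c :* (u :* y))) refl (u i) (ι (bd r)) (y i) ⟩
    u i * (ι (bd r) * (u i * y i)) ≡⟨ cong (λ a → u i * (ι (bd r) * a)) (u*y i) ⟩
    u i * (ι (bd r) * e i) ≤⟨ *-monoʳ (0≤* (0≤ι (bd r)) (0≤e i)) (u≤3v i) ⟩
    ι 3 * v i * (ι (bd r) * e i)
      ≡⟨ solve 3 (λ v c e → con (ι 3) :* v :* (c :* e) := con (ι 3) :* c :* (v :* e)) refl (v i) (ι (bd r)) (e i) ⟩
    K * (v i * e i) ∎
    where open +-*-Solver

  sum-mono : ∀ {m n} → m ℕ.≤ n → sumTo f m ≤ sumTo f n
  sum-mono {m} {n} le = subst₂ _≤_ (neg-neg (sumTo f m)) (neg-neg (sumTo f n))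
    (ℚ.neg-antimono-≤ (antitone (λ k → - sumTo f k) (λ i → ℚ.neg-antimono-≤ (p≤p+q {sumTo f i} {f (suc i)} (0≤f i))) le))
    where
    open +-*-Solver
    neg-neg : ∀ p → - (- p) ≡ p
    neg-neg p = solve 1 (λ p → :- (:- p) := p) refl p

  remainder : ∀ {m n} → m ℕ.≤ n → sumTo f n ≤ sumTo f m + K * e m
  remainder {m} {n} le = ℚ.≤-trans (p≤p+q {sumTo f n} {K * e n} (0≤* {K} {e n} 0≤K (0≤e n)))
    (antitone (λ k → sumTo f k + K * e k) step le)
    where
    open +-*-Solver
    step : ∀ i → sumTo f (suc i) + K * e (suc i) ≤ sumTo f i + K * e i
    step i = begin
      sumTo f i + f (suc i) + K * e (suc i)
        ≤⟨ ℚ.+-monoˡ-≤ (K * e (suc i)) (ℚ.+-monoʳ-≤ (sumTo f i) (f≤′ i)) ⟩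
      sumTo f i + K * (v i * e i) + K * e (suc i)
        ≡⟨ solve 4 (λ s K a b → s :+ K :* a :+ K :* b := s :+ K :* (b :+ a)) refl (sumTo f i) K (v i * e i) (e (suc i)) ⟩
      sumTo f i + K * (e (suc i) + v i * e i)
        ≡⟨ cong (λ a → sumTo f i + K * a) (e-step i) ⟩
      sumTo f i + K * e i ∎

  diff≤ : ∀ {m n} → m ℕ.≤ n → ∣ sumTo f n - sumTo f m ∣ ≤ K * e m
  diff≤ {m} {n} le = subst (_≤ K * e m) (sym (ℚ.0≤p⇒∣p∣≡p (p≤q⇒0≤q-p {sumTo f m} {sumTo f n} (sum-mono le))))
    (p≤q+r⇒p-q≤r {sumTo f n} {sumTo f m} {K * e m} (remainder le))

  bound : ∀ {ε} N → K * e N < ε → ∀ m n → N ℕ.≤ m → N ℕ.≤ n → ∣ sumTo f m - sumTo f n ∣ < ε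
  bound {ε} N Ke<ε m n hm hn = case (ℕ.≤-total m n)
    where
    case : m ℕ.≤ n ⊎ n ℕ.≤ m → ∣ sumTo f m - sumTo f n ∣ < ε
    case (inj₁ m≤n) = begin-strict
      ∣ sumTo f m - sumTo f n ∣ ≡⟨ ∣-∣-swap (sumTo f m) (sumTo f n) ⟩
      ∣ sumTo f n - sumTo f m ∣ ≤⟨ diff≤ m≤n ⟩
      K * e m                   ≤⟨ *-monoˡ {K} {e m} {e N} 0≤K (e-anti {N} {m} hm) ⟩
      K * e N                   <⟨ Ke<ε ⟩
      ε                         ∎
    case (inj₂ n≤m) = begin-strict
      ∣ sumTo f m - sumTo f n ∣ ≤⟨ diff≤ n≤m ⟩
      K * e n                   ≤⟨ *-monoˡ {K} {e n} {e N} 0≤K (e-anti {N} {n} hn) ⟩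
      K * e N                   <⟨ Ke<ε ⟩
      ε                         ∎

  abstract
    sumTo-cauchy : IsCauchy (sumTo f)
    sumTo-cauchy ε 0<ε = let (N , Ke<ε) = e→0 K 0≤K ε 0<ε in N , bound N Ke<ε

-- k ^⁻ a is k^{-a}; only k ≥ 1 ever occurs in a sum below
infixl 8 _^⁻_
_^⁻_ : ℕ → ℕ → ℚ
zero  ^⁻ a = 0ℚ
suc k ^⁻ a = (+ 1 / (suc k ℕ.^ a)) {{ℕ.m^n≢0 (suc k) a}}

-- The exponents are listed from the largest summation index inwards, so that
--   nested pred (a₁ ∷ … ∷ aᵣ ∷ []) N = Σ_{N ≥ k₁ > … > kᵣ ≥ 1} k₁^{-a₁} ⋯ kᵣ^{-aᵣ}
--   nested id   (a₁ ∷ … ∷ aᵣ ∷ []) N = Σ_{N ≥ k₁ ≥ … ≥ kᵣ ≥ 1} k₁^{-a₁} ⋯ kᵣ^{-aᵣ}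
nested : (ℕ → ℕ) → List ℕ → ℕ → ℚ
nested s []       N = 1ℚ
nested s (a ∷ as) N = sumTo (λ k → k ^⁻ a * nested s as (s k)) N

-- α₁, …, αᵣ ≥ 1 and αᵣ ≥ 2, with r ≥ 1
data Admissible : List ℕ → Set where
  last : ∀ {a} → 2 ℕ.≤ a → Admissible [ a ]
  _∷_  : ∀ {a as} → 1 ℕ.≤ a → Admissible as → Admissible (a ∷ as)

1/-anti : ∀ m n .{{_ : ℕ.NonZero m}} .{{_ : ℕ.NonZero n}} → m ℕ.≤ n → + 1 / n ≤ + 1 / m
1/-anti (suc m) (suc n) (ℕ.s≤s le) = u-anti le

0≤^⁻ : ∀ k a → 0ℚ ≤ k ^⁻ a
0≤^⁻ zero    a = ℚ.≤-refl
0≤^⁻ (suc k) a = lemma (suc k ℕ.^ a) {{ℕ.m^n≢0 (suc k) a}}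
  where
  lemma : ∀ m .{{_ : ℕ.NonZero m}} → 0ℚ ≤ + 1 / m
  lemma (suc m) = 0≤u m

^⁻≤u : ∀ k {a} → 1 ℕ.≤ a → suc k ^⁻ a ≤ u k
^⁻≤u k {a} le = 1/-anti (suc k) (suc k ℕ.^ a) {{_}} {{ℕ.m^n≢0 (suc k) a}}
  (subst (ℕ._≤ suc k ℕ.^ a) (ℕ.*-identityʳ (suc k)) (ℕ.^-monoʳ-≤ (suc k) le))

^⁻≤u² : ∀ k {a} → 2 ℕ.≤ a → suc k ^⁻ a ≤ u k * u k
^⁻≤u² k {a} le = subst (suc k ^⁻ a ≤_) (sym (/-* (+ 1) k (+ 1) k))
  (1/-anti (suc k ℕ.* suc k) (suc k ℕ.^ a) {{_}} {{ℕ.m^n≢0 (suc k) a}}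
    (subst (λ m → suc k ℕ.* m ℕ.≤ suc k ℕ.^ a) (ℕ.*-identityʳ (suc k)) (ℕ.^-monoʳ-≤ (suc k) le)))

H-mono : ∀ {m n} → m ℕ.≤ n → H m ≤ H n
H-mono {m} le = go (ℕ.≤⇒≤′ le)
  where
  go : ∀ {n} → m ℕ.≤′ n → H m ≤ H n
  go (ℕ.≤′-reflexive refl) = ℚ.≤-refl
  go (ℕ.≤′-step {n} q)     = ℚ.≤-trans (go q) (p≤p+q {H n} {u n} (0≤u n))

0≤sumTo : ∀ {f} → (∀ k → 0ℚ ≤ f k) → ∀ N → 0ℚ ≤ sumTo f N
0≤sumTo 0≤f zero    = ℚ.≤-refl
0≤sumTo 0≤f (suc N) = 0≤+ (0≤sumTo 0≤f N) (0≤f (suc N))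

sumTo≤H^ : ∀ {f} l → (∀ i → f (suc i) ≤ u i * H (suc i) ^ℚ l) → ∀ N → sumTo f N ≤ H N ^ℚ suc l
sumTo≤H^ l f≤ zero = ℚ.≤-reflexive (sym (ℚ.*-zeroˡ (0ℚ ^ℚ l)))
sumTo≤H^ {f} l f≤ (suc N) = begin
  sumTo f N + f (suc N)
    ≤⟨ ℚ.+-mono-≤ (sumTo≤H^ l f≤ N) (f≤ N) ⟩
  H N * H N ^ℚ l + u N * H (suc N) ^ℚ l
    ≤⟨ ℚ.+-monoˡ-≤ (u N * H (suc N) ^ℚ l) (*-monoˡ {H N} (0≤H N) (^-mono (0≤H N) (H-mono (ℕ.n≤1+n N)) l)) ⟩
  H N * H (suc N) ^ℚ l + u N * H (suc N) ^ℚ l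
    ≡⟨ ℚ.*-distribʳ-+ (H (suc N) ^ℚ l) (H N) (u N) ⟨
  H (suc N) ^ℚ suc l ∎

0≤nested : ∀ s as N → 0ℚ ≤ nested s as N
0≤nested s []       N = 0≤1
0≤nested s (a ∷ as) N = 0≤sumTo (λ k → 0≤* (0≤^⁻ k a) (0≤nested s as (s k))) N

nested≤H^ : ∀ s → (∀ k → s k ℕ.≤ k) → ∀ {as} → All (1 ℕ.≤_) as → ∀ N → nested s as N ≤ H N ^ℚ length as
nested-s≤H^ : ∀ s → (∀ k → s k ℕ.≤ k) → ∀ {as} → All (1 ℕ.≤_) as → ∀ k → nested s as (s k) ≤ H k ^ℚ length as

nested≤H^ s hs []                N = ℚ.≤-refl
nested≤H^ s hs {a ∷ as} (p ∷ ps) N = sumTo≤H^ (length as)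
  (λ i → *-mono (0≤nested s as (s (suc i))) (0≤u i) (^⁻≤u i p) (nested-s≤H^ s hs ps (suc i))) N

nested-s≤H^ s hs {as} ps k = ℚ.≤-trans (nested≤H^ s hs ps (s k)) (^-mono (0≤H (s k)) (H-mono (hs k)) (length as))

reverse-admissible : ∀ {as} → Admissible as → ∃₂ λ b bs → reverse as ≡ b ∷ bs × 2 ℕ.≤ b × All (1 ℕ.≤_) bs
reverse-admissible {a ∷ []} (last 2≤a) = a , [] , refl , 2≤a , []
reverse-admissible {a ∷ as} (1≤a ∷ h) =
  let (b , bs , eq , 2≤b , 1≤bs) = reverse-admissible h
  in b , bs ∷ʳ a , trans (unfold-reverse a as) (cong (_∷ʳ a) eq) , 2≤b , ∷ʳ⁺ 1≤bs 1≤a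

nested-cauchy : ∀ s → (∀ k → s k ℕ.≤ k) → ∀ {α} → Admissible α → IsCauchy (nested s (reverse α))
nested-cauchy s hs h =
  let (b , bs , eq , 2≤b , 1≤bs) = reverse-admissible h
  in subst (λ as → IsCauchy (nested s as)) (sym eq)
       (Series.sumTo-cauchy (λ k → k ^⁻ b * nested s bs (s k)) (length bs)
         (λ i → 0≤* (0≤^⁻ (suc i) b) (0≤nested s bs (s (suc i))))
         (λ i → *-mono (0≤nested s bs (s (suc i))) (0≤* (0≤u i) (0≤u i)) (^⁻≤u² i 2≤b) (nested-s≤H^ s hs 1≤bs (suc i))))

-- The N-th approximation is the sum over all index tuples with largest index ≤ N.
-- α is listed in the order α₁, …, αᵣ, where αᵣ belongs to the largest index.
ζ : (α : List ℕ) → Admissible α → ℝ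
ζ α h = mkℝ (nested pred (reverse α)) (nested-cauchy pred (λ k → ℕ.pred[n]≤n) h)

ζ★ : (α : List ℕ) → Admissible α → ℝ
ζ★ α h = mkℝ (nested id (reverse α)) (nested-cauchy id (λ k → ℕ.≤-refl) h)

-- the part of G_{n+2}(p,q) with k_{p+1} = k, so that k₁ < ⋯ < k_p ≤ k - 1 and
-- ℓ₁ ≤ ⋯ ≤ ℓ_q ≤ k
G-term : ℕ → ℕ → ℕ → ℕ → ℚ
G-term n p q k = k ^⁻ (n ℕ.+ 2) * (nested pred (replicate p 1) (pred k) * nested id (replicate q 1) k)

G-cauchy : ∀ n p q → IsCauchy (sumTo (G-term n p q))
G-cauchy n p q = Series.sumTo-cauchy (G-term n p q) (p ℕ.+ q)
  (λ i → 0≤* (0≤^⁻ (suc i) (n ℕ.+ 2)) (0≤* (0≤nested pred (replicate p 1) i) (0≤nested id (replicate q 1) (suc i))))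
  (λ i → *-mono (0≤* (0≤nested pred (replicate p 1) i) (0≤nested id (replicate q 1) (suc i)))
    (0≤* (0≤u i) (0≤u i)) (^⁻≤u² i (ℕ.m≤n+m 2 n)) (bound i))
  where
  ones : ∀ r → All (1 ℕ.≤_) (replicate r 1)
  ones r = replicate⁺ r ℕ.≤-refl
  bound : ∀ i → nested pred (replicate p 1) i * nested id (replicate q 1) (suc i) ≤ H (suc i) ^ℚ (p ℕ.+ q)
  bound i = begin
    nested pred (replicate p 1) i * nested id (replicate q 1) (suc i)
      ≤⟨ *-mono (0≤nested id (replicate q 1) (suc i)) (0≤^ (0≤H (suc i)) (length (replicate p 1)))
           (nested-s≤H^ pred (λ k → ℕ.pred[n]≤n) (ones p) (suc i))
           (nested≤H^ id (λ k → ℕ.≤-refl) (ones q) (suc i)) ⟩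
    H (suc i) ^ℚ length (replicate p 1) * H (suc i) ^ℚ length (replicate q 1)
      ≡⟨ cong₂ (λ a b → H (suc i) ^ℚ a * H (suc i) ^ℚ b) (length-replicate p) (length-replicate q) ⟩
    H (suc i) ^ℚ p * H (suc i) ^ℚ q ≡⟨ ^-+ (H (suc i)) p q ⟨
    H (suc i) ^ℚ (p ℕ.+ q) ∎

-- G[ n +2] p q is G_{n+2}(p,q)
G[_+2] : (n p q : ℕ) → ℝ
G[ n +2] p q = mkℝ (sumTo (G-term n p q)) (G-cauchy n p q)

-- all (p , q) with p + q = m
splits : ℕ → List (ℕ × ℕ)
splits m = applyUpTo (λ p → p , m ℕ.∸ p) (suc m)

-- all k-tuples of nonnegative integers with sum m
tuples : ∀ k → ℕ → List (Vec ℕ k)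
tuples zero    zero    = [ [] ]
tuples zero    (suc m) = []
tuples (suc k) m       = concatMap (λ (c , d) → map (c ∷_) (tuples k d)) (splits m)

ones-admissible : ∀ p {a} → 2 ℕ.≤ a → Admissible (replicate p 1 ++ [ a ])
ones-admissible zero    h = last h
ones-admissible (suc p) h = ℕ.≤-refl ∷ ones-admissible p h

2n+4-admissible : ∀ n → Admissible [ 2 ℕ.* n ℕ.+ 4 ]
2n+4-admissible n = last (ℕ.≤-trans (ℕ.m≤m+n 2 2) (ℕ.m≤n+m 4 (2 ℕ.* n)))

-- (c₀ + 3, c₁ + 2, …, cⱼ + 2)
shift : ∀ {j} → Vec ℕ (suc j) → List ℕ
shift (c₀ ∷ cs) = c₀ ℕ.+ 3 ∷ map (ℕ._+ 2) (toList cs)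

shift-admissible : ∀ {j} (c : Vec ℕ (suc j)) → Admissible (shift c)
shift-admissible (c₀ ∷ cs) = go (ℕ.≤-trans (ℕ.n≤1+n 2) (ℕ.m≤n+m 3 c₀)) cs
  where
  go : ∀ {a} → 2 ℕ.≤ a → ∀ {j} (cs : Vec ℕ j) → Admissible (a ∷ map (ℕ._+ 2) (toList cs))
  go h []       = last h
  go h (c ∷ cs) = ℕ.≤-trans (ℕ.n≤1+n 1) h ∷ go (ℕ.m≤n+m 2 c) cs

W : ∀ {j} → Vec ℕ (suc j) → ℕ
W (c₀ ∷ cs) = ((c₀ ℕ.+ 3) C 3) ℕ.* product (map (ℕ._+ 1) (toList cs))

{-# OPTIONS --safe #-}

-- Summed over the weight, both sides are coefficients of power series in X, and the theorem is the coefficient of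
-- X^(2n+1) of a transformation of a ₃F₂(1), differentiated in a parameter.  That transformation has an exact version for
-- truncated sums (the Saalschützian case of Whipple's ₄F₃ transformation): the right-hand side truncated at N equals the
-- left-hand side truncated at N, once its summand with largest index k is multiplied by ∏_{i<k} (N-i)/(N-i-X).  Passing
-- from N to N + 1, the difference of the two summands telescopes in k, so the identity follows by induction on N.  The
-- coefficients of these factors are close enough to those of 1 to make the error O(log^r N / N).

module Submission where

open import Defs
open import Algebra.Bundles using (CommutativeSemiring)
import Algebra.Properties.Group as GroupProperties
import Algebra.Solver.Ring.NaturalCoefficients.Default as NaturalCoefficients
open import Algebra.Structures using (IsCommutativeSemiring; IsCommutativeMonoid)
open import Algebra.Structures.Biased using (isCommutativeSemiringˡ)
import Data.Integer as ℤ
open import Data.List using (List; []; _∷_; map; foldr; concatMap; reverse)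
open import Data.List.Properties using (map-++; reverse-++; unfold-reverse; length-replicate)
open import Data.List.Relation.Unary.All.Properties using (replicate⁺)
open import Data.Nat as ℕ using (zero; pred; s≤s; z≤n)
open import Data.Nat.Combinatorics using (nC1≡n; nCk+nC[k+1]≡[n+1]C[k+1]; nCn≡1)
open import Data.Nat.ListAction using (product)
open import Data.Nat.ListAction.Properties using (product-++)
import Data.Nat.Properties as ℕ
open import Data.Product using (_×_)
import Data.Rational as ℚ
import Data.Rational.Properties as ℚ
open import Data.Rational.Solver using (module +-*-Solver)
open import Data.Vec using (Vec; []; _∷_; _∷ʳ_; toList)
open import Data.Vec.Properties using (toList-∷ʳ)
open import Function using (id)
open import Level using (0ℓ)
open import Relation.Binary.PropositionalEquality using (_≡_; refl; sym; trans; cong; cong₂; subst; subst₂; module ≡-Reasoning)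
import Relation.Binary.Reasoning.Setoid as SetoidReasoning
open import Relation.Binary.Structures using (IsEquivalence)

-- The weight p + 1 in front of ζ★ is what differentiating the generating product `P` in X produces.
-- The logarithmic derivative of `P k` is the sum of 1/(i - X) over i ≤ k; the G-sums remove from it
-- the harmonic number of the smaller indices, and what remains is `A`. With α = 1/(M + 1 - X),
-- telescoping yields the first-order recurrence S(M+1) = (1 - X²α²) S(M) + α³ (M+1) α. Solving it
-- produces nested sums: the smallest index k contributes k/(k - X)^4 and every larger one -X²/(k -
-- X)². Each extra index uses up two powers of X, so a fixed coefficient sees only finitely many of
-- them. For the limit, all series involved have nonnegative coefficients and the cutoff has
-- constant term 1 for k ≤ N, so inserting it can only increase a coefficient. Its coefficients of
-- positive degree are of size k/N up to logarithms.

module Approximation where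

  open import Data.Integer using (-1ℤ)
  open import Data.List using ([_]; _++_; applyUpTo; replicate)
  open import Data.Nat using (ℕ; suc)
  open import Data.Nat.Combinatorics using (_C_)
  open import Data.Product using (_,_)
  open import Data.Rational using (ℚ; 0ℚ; 1ℚ; _+_; _*_; _-_; -_; _/_; _≤_; _<_; ∣_∣)
  open GroupProperties ℚ.+-0-group using (∙-cancelʳ)

  -- Sums over antidiagonals

  -- diag F m = Σ_{p+q=m} F p q
  diag : (ℕ → ℕ → ℚ) → ℕ → ℚ
  diag F zero    = F 0 0
  diag F (suc m) = F 0 (suc m) + diag (λ p → F (suc p)) m

  diag-cong : ∀ {F G} → (∀ p q → F p q ≡ G p q) → ∀ m → diag F m ≡ diag G m
  diag-cong h zero    = h 0 0
  diag-cong h (suc m) = cong₂ _+_ (h 0 (suc m)) (diag-cong (λ p → h (suc p)) m)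

  diag-+ : ∀ F G m → diag (λ p q → F p q + G p q) m ≡ diag F m + diag G m
  diag-+ F G zero    = refl
  diag-+ F G (suc m) = trans
    (cong (F 0 (suc m) + G 0 (suc m) +_) (diag-+ (λ p → F (suc p)) (λ p → G (suc p)) m))
    (solve 4 (λ a b c d → (a :+ b) :+ (c :+ d) := (a :+ c) :+ (b :+ d)) refl
      (F 0 (suc m)) (G 0 (suc m)) (diag (λ p → F (suc p)) m) (diag (λ p → G (suc p)) m))
    where open +-*-Solver

  diag-*ˡ : ∀ c F m → diag (λ p q → c * F p q) m ≡ c * diag F m
  diag-*ˡ c F zero    = refl
  diag-*ˡ c F (suc m) = trans (cong (c * F 0 (suc m) +_) (diag-*ˡ c (λ p → F (suc p)) m))
    (sym (ℚ.*-distribˡ-+ c (F 0 (suc m)) (diag (λ p → F (suc p)) m)))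

  diag-*ʳ : ∀ c F m → diag (λ p q → F p q * c) m ≡ diag F m * c
  diag-*ʳ c F m = trans (diag-cong (λ p q → ℚ.*-comm (F p q) c) m)
    (trans (diag-*ˡ c F m) (ℚ.*-comm c (diag F m)))

  diag-zero : ∀ m → diag (λ _ _ → 0ℚ) m ≡ 0ℚ
  diag-zero zero    = refl
  diag-zero (suc m) = trans (ℚ.+-identityˡ _) (diag-zero m)

  diag-suc : ∀ F m → diag F (suc m) ≡ diag (λ p q → F p (suc q)) m + F (suc m) 0
  diag-suc F zero    = refl
  diag-suc F (suc m) = trans
    (cong (F 0 (suc (suc m)) +_) (diag-suc (λ p → F (suc p)) m))
    (sym (ℚ.+-assoc (F 0 (suc (suc m))) _ _))

  diag-flip : ∀ F m → diag F m ≡ diag (λ p q → F q p) m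
  diag-flip F zero    = refl
  diag-flip F (suc m) = trans (diag-suc F m) (trans (ℚ.+-comm _ (F (suc m) 0))
    (cong (F (suc m) 0 +_) (diag-flip (λ p q → F p (suc q)) m)))

  -- Serves twice: for associativity of the Cauchy product, and in `tuples-∷ʳ` to pass from
  -- splitting off the first entry of a tuple to splitting off the last.
  diag-assoc : ∀ (F : ℕ → ℕ → ℕ → ℚ) m →
    diag (λ s r → diag (λ p q → F p q r) s) m ≡ diag (λ p t → diag (λ q r → F p q r) t) m
  diag-assoc F zero    = refl
  diag-assoc F (suc m) = begin
    F 0 0 (suc m) + diag (λ s r → F 0 (suc s) r + diag (λ p q → F (suc p) q r) s) m
      ≡⟨ cong (F 0 0 (suc m) +_) (diag-+ (λ s r → F 0 (suc s) r) (λ s r → diag (λ p q → F (suc p) q r) s) m) ⟩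
    F 0 0 (suc m) + (diag (λ s r → F 0 (suc s) r) m + diag (λ s r → diag (λ p q → F (suc p) q r) s) m)
      ≡⟨ cong (λ a → F 0 0 (suc m) + (diag (λ s r → F 0 (suc s) r) m + a)) (diag-assoc (λ p → F (suc p)) m) ⟩
    F 0 0 (suc m) + (diag (λ s r → F 0 (suc s) r) m + diag (λ p t → diag (λ q r → F (suc p) q r) t) m)
      ≡⟨ ℚ.+-assoc (F 0 0 (suc m)) _ _ ⟨
    F 0 0 (suc m) + diag (λ s r → F 0 (suc s) r) m + diag (λ p t → diag (λ q r → F (suc p) q r) t) m ∎
    where open ≡-Reasoning

  diag-head : ∀ F m → (∀ p q → F p (suc q) ≡ 0ℚ) → diag F m ≡ F m 0
  diag-head F zero    h = refl
  diag-head F (suc m) h = trans (diag-suc F m)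
    (trans (cong (_+ F (suc m) 0) (trans (diag-cong h m) (diag-zero m))) (ℚ.+-identityˡ (F (suc m) 0)))

  0≤diag : ∀ {F} → (∀ p q → 0ℚ ≤ F p q) → ∀ m → 0ℚ ≤ diag F m
  0≤diag h zero    = h 0 0
  0≤diag h (suc m) = 0≤+ (h 0 (suc m)) (0≤diag (λ p → h (suc p)) m)

  diag≤ : ∀ F B m → (∀ p q → p ℕ.+ q ≡ m → F p q ≤ B) → diag F m ≤ ι (suc m) * B
  diag≤ F B zero    h = ℚ.≤-trans (h 0 0 refl) (ℚ.≤-reflexive (sym (ℚ.*-identityˡ B)))
  diag≤ F B (suc m) h = begin
    F 0 (suc m) + diag (λ p → F (suc p)) m
      ≤⟨ ℚ.+-mono-≤ (h 0 (suc m) refl) (diag≤ (λ p → F (suc p)) B m (λ p q eq → h (suc p) q (cong suc eq))) ⟩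
    B + ι (suc m) * B
      ≡⟨ solve 2 (λ b n → b :+ n :* b := (con 1ℚ :+ n) :* b) refl B (ι (suc m)) ⟩
    (1ℚ + ι (suc m)) * B ≡⟨ cong (_* B) (ι-+ 1 (suc m)) ⟨
    ι (suc (suc m)) * B ∎
    where
    open ℚ.≤-Reasoning
    open +-*-Solver

  -- Power series over ℚ as a commutative semiring

  -- Power series are used as a cancellative semiring: in the identities below all terms are moved so that no subtraction
  -- occurs.  Without eta, and with copatterns, the operations on them do not unfold during unification.
  record Powerseries : Set where
    no-eta-equality
    constructor series
    field
      coeff : ℕ → ℚ
  open Powerseries public

  infix 4 _≋_
  record _≋_ (f g : Powerseries) : Set where
    constructor mk≋
    field
      coeff≡ : ∀ m → coeff f m ≡ coeff g m
  open _≋_ public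

  infixl 6 _⊕_
  infixl 7 _⊛_

  _⊕_ _⊛_ : Powerseries → Powerseries → Powerseries
  coeff (f ⊕ g) m = coeff f m + coeff g m
  coeff (f ⊛ g)   = diag λ p q → coeff f p * coeff g q

  const : ℚ → Powerseries
  coeff (const c) zero    = c
  coeff (const c) (suc _) = 0ℚ

  shiftʳ : (ℕ → ℚ) → ℕ → ℚ
  shiftʳ s zero    = 0ℚ
  shiftʳ s (suc m) = s m

  X : Powerseries
  coeff X zero          = 0ℚ
  coeff X (suc zero)    = 1ℚ
  coeff X (suc (suc _)) = 0ℚ

  𝟘 𝟙 : Powerseries
  𝟘 = const 0ℚ
  𝟙 = const 1ℚ

  -- The substitute for subtraction: negatives exist in each coefficient, but not in the semiring
  -- that the solver works with.
  ⊕-cancelʳ : ∀ h {f g} → f ⊕ h ≋ g ⊕ h → f ≋ g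
  ⊕-cancelʳ h eq = mk≋ λ m → ∙-cancelʳ (coeff h m) _ _ (coeff≡ eq m)

  coeff-const : ∀ c f m → coeff (const c ⊛ f) m ≡ c * coeff f m
  coeff-const c f zero    = refl
  coeff-const c f (suc m) = trans
    (cong (c * coeff f (suc m) +_) (trans (diag-cong (λ p q → ℚ.*-zeroˡ (coeff f q)) m) (diag-zero m)))
    (ℚ.+-identityʳ _)

  coeff-X : ∀ f m → coeff (X ⊛ f) m ≡ shiftʳ (coeff f) m
  coeff-X f zero    = ℚ.*-zeroˡ (coeff f 0)
  coeff-X f (suc m) = trans (cong (_+ diag (λ p q → coeff X (suc p) * coeff f q) m) (ℚ.*-zeroˡ (coeff f (suc m))))
    (trans (ℚ.+-identityˡ _)
      (trans (diag-cong (λ { zero q → refl ; (suc p) q → refl }) m)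
        (trans (coeff-const 1ℚ f m) (ℚ.*-identityˡ (coeff f m)))))

  ≋-isEquivalence : IsEquivalence _≋_
  ≋-isEquivalence = record
    { refl  = mk≋ λ m → refl
    ; sym   = λ eq → mk≋ λ m → sym (coeff≡ eq m)
    ; trans = λ eq₁ eq₂ → mk≋ λ m → trans (coeff≡ eq₁ m) (coeff≡ eq₂ m)
    }

  ⊕-isCommutativeMonoid : IsCommutativeMonoid _≋_ _⊕_ 𝟘
  ⊕-isCommutativeMonoid = record
    { isMonoid = record
      { isSemigroup = record
        { isMagma = record
          { isEquivalence = ≋-isEquivalence
          ; ∙-cong        = λ eq₁ eq₂ → mk≋ λ m → cong₂ _+_ (coeff≡ eq₁ m) (coeff≡ eq₂ m)
          }
        ; assoc   = λ f g h → mk≋ λ m → ℚ.+-assoc (coeff f m) (coeff g m) (coeff h m)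
        }
      ; identity    = (λ f → mk≋ λ { zero → ℚ.+-identityˡ (coeff f 0) ; (suc m) → ℚ.+-identityˡ (coeff f (suc m)) })
                    , (λ f → mk≋ λ { zero → ℚ.+-identityʳ (coeff f 0) ; (suc m) → ℚ.+-identityʳ (coeff f (suc m)) })
      }
    ; comm     = λ f g → mk≋ λ m → ℚ.+-comm (coeff f m) (coeff g m)
    }

  ⊛-comm : ∀ f g → f ⊛ g ≋ g ⊛ f
  ⊛-comm f g = mk≋ λ m → trans (diag-flip _ m) (diag-cong (λ p q → ℚ.*-comm (coeff f q) (coeff g p)) m)

  ⊛-assoc : ∀ f g h → (f ⊛ g) ⊛ h ≋ f ⊛ (g ⊛ h)
  ⊛-assoc f g h = mk≋ λ m → begin
    diag (λ s r → diag (λ p q → coeff f p * coeff g q) s * coeff h r) m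
      ≡⟨ diag-cong (λ s r → sym (diag-*ʳ (coeff h r) (λ p q → coeff f p * coeff g q) s)) m ⟩
    diag (λ s r → diag (λ p q → coeff f p * coeff g q * coeff h r) s) m
      ≡⟨ diag-assoc (λ p q r → coeff f p * coeff g q * coeff h r) m ⟩
    diag (λ p t → diag (λ q r → coeff f p * coeff g q * coeff h r) t) m
      ≡⟨ diag-cong (λ p t → trans (diag-cong (λ q r → ℚ.*-assoc (coeff f p) (coeff g q) (coeff h r)) t)
                                  (diag-*ˡ (coeff f p) (λ q r → coeff g q * coeff h r) t)) m ⟩
    diag (λ p t → coeff f p * diag (λ q r → coeff g q * coeff h r) t) m ∎
    where open ≡-Reasoning

  ⊛-identityˡ : ∀ f → 𝟙 ⊛ f ≋ f
  ⊛-identityˡ f = mk≋ λ m → trans (coeff-const 1ℚ f m) (ℚ.*-identityˡ (coeff f m))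

  ⊛-isCommutativeMonoid : IsCommutativeMonoid _≋_ _⊛_ 𝟙
  ⊛-isCommutativeMonoid = record
    { isMonoid = record
      { isSemigroup = record
        { isMagma = record
          { isEquivalence = ≋-isEquivalence
          ; ∙-cong        = λ eq₁ eq₂ → mk≋ λ m → diag-cong (λ p q → cong₂ _*_ (coeff≡ eq₁ p) (coeff≡ eq₂ q)) m
          }
        ; assoc   = ⊛-assoc
        }
      ; identity    = ⊛-identityˡ , λ f → IsEquivalence.trans ≋-isEquivalence (⊛-comm f 𝟙) (⊛-identityˡ f)
      }
    ; comm     = ⊛-comm
    }

  ⊛-⊕-isCommutativeSemiring : IsCommutativeSemiring _≋_ _⊕_ _⊛_ 𝟘 𝟙
  ⊛-⊕-isCommutativeSemiring = isCommutativeSemiringˡ record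
    { +-isCommutativeMonoid = ⊕-isCommutativeMonoid
    ; *-isCommutativeMonoid = ⊛-isCommutativeMonoid
    ; distribʳ = λ f g h → mk≋ λ m → trans
        (diag-cong (λ p q → ℚ.*-distribʳ-+ (coeff f q) (coeff g p) (coeff h p)) m)
        (diag-+ (λ p q → coeff g p * coeff f q) (λ p q → coeff h p * coeff f q) m)
    ; zeroˡ = λ f → mk≋ λ m → trans (coeff-const 0ℚ f m) (trans (ℚ.*-zeroˡ (coeff f m)) (sym (0≡ m)))
    }
    where
    0≡ : ∀ m → coeff 𝟘 m ≡ 0ℚ
    0≡ zero    = refl
    0≡ (suc m) = refl

  powerseriesSemiring : CommutativeSemiring 0ℓ 0ℓ
  powerseriesSemiring = record { isCommutativeSemiring = ⊛-⊕-isCommutativeSemiring }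

  module ≋ = CommutativeSemiring powerseriesSemiring
  module PowerseriesSolver = NaturalCoefficients powerseriesSemiring

  -- Expresses f - g = c (l - r). An identity that holds modulo the relation l ≋ r is thus proved by
  -- naming its cofactor c; what is left is a polynomial identity for the solver.
  ⊕-cancel-multiple : ∀ c {f g l r} → l ≋ r → f ⊕ c ⊛ r ≋ g ⊕ c ⊛ l → f ≋ g
  ⊕-cancel-multiple c {l = l} l≋r eq = ⊕-cancelʳ (c ⊛ l)
    (≋.trans (≋.+-cong ≋.refl (≋.*-cong (≋.refl {c}) l≋r)) eq)

  const-+ : ∀ a b → const (a + b) ≋ const a ⊕ const b
  const-+ a b = mk≋ λ { zero → refl ; (suc m) → refl }

  const-* : ∀ a b → const (a * b) ≋ const a ⊛ const b
  const-* a b = mk≋ λ { zero → refl ; (suc m) → sym (trans (coeff-const a (const b) (suc m)) (ℚ.*-zeroʳ a)) }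

  const-cong : ∀ {a b} → a ≡ b → const a ≋ const b
  const-cong refl = ≋.refl

  -- Geometric series and the rational identity behind the telescoping

  -- geo k = 1 / (1 - X/(k+1)) and inv k = 1 / (k+1 - X)

  geo inv : ℕ → Powerseries
  coeff (geo k) = u k ^ℚ_
  inv k = const (u k) ⊛ geo k

  geo≋ : ∀ k → geo k ≋ 𝟙 ⊕ X ⊛ inv k
  geo≋ k = mk≋ λ
    { zero    → sym (cong (1ℚ +_) (coeff-X (inv k) 0))
    ; (suc m) → sym (trans (ℚ.+-identityˡ _) (trans (coeff-X (inv k) (suc m)) (coeff-const (u k) (geo k) m))) }

  -- The hypothesis is (1 - X/(k+1)) f = g without the minus sign. Adding `X ⊛ inv k ⊛ f` turns f
  -- into `geo k ⊛ f`, and substituting the hypothesis for f once reproduces the added term.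
  geo-unique : ∀ k {f g} → f ≋ g ⊕ const (u k) ⊛ (X ⊛ f) → f ≋ geo k ⊛ g
  geo-unique k {f} {g} eq = ⊕-cancelʳ (X ⊛ inv k ⊛ f) (begin
    f ⊕ X ⊛ inv k ⊛ f
      ≈⟨ solve 2 (λ a f → f :+ a :* f := (con 1 :+ a) :* f) ≋.refl (X ⊛ inv k) f ⟩
    (𝟙 ⊕ X ⊛ inv k) ⊛ f ≈⟨ ≋.*-cong (≋.sym (geo≋ k)) eq ⟩
    geo k ⊛ (g ⊕ const (u k) ⊛ (X ⊛ f))
      ≈⟨ solve 5 (λ q c x f g → q :* (g :+ c :* (x :* f)) := q :* g :+ x :* (c :* q) :* f) ≋.refl
           (geo k) (const (u k)) X f g ⟩
    geo k ⊛ g ⊕ X ⊛ inv k ⊛ f ∎)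
    where
    open PowerseriesSolver
    open SetoidReasoning ≋.setoid

  inv≋ : ∀ k → const (ι (suc k)) ⊛ inv k ≋ 𝟙 ⊕ X ⊛ inv k
  inv≋ k = ≋.trans (≋.sym (≋.*-assoc (const (ι (suc k))) (const (u k)) (geo k)))
    (≋.trans (≋.*-cong (≋.trans (≋.sym (const-* (ι (suc k)) (u k))) (const-cong (u-inv k))) (geo≋ k))
      (≋.*-identityˡ (𝟙 ⊕ X ⊛ inv k)))

  -- 1/α = 1/β + 1/δ + X for α, β, δ = inv (k + suc d), inv k, inv d
  inv-+ : ∀ k d → inv (k ℕ.+ suc d) ⊛ (inv k ⊕ inv d ⊕ X ⊛ inv k ⊛ inv d) ≋ inv k ⊛ inv d
  inv-+ k d = ≋.sym (⊕-cancelʳ (X ⊛ α ⊛ β ⊛ δ) (begin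
    β ⊛ δ ⊕ X ⊛ α ⊛ β ⊛ δ
      ≈⟨ solve 4 (λ x a b d → b :* d :+ x :* a :* b :* d := b :* d :* (con 1 :+ x :* a)) ≋.refl X α β δ ⟩
    β ⊛ δ ⊛ (𝟙 ⊕ X ⊛ α) ≈⟨ ≋.*-cong ≋.refl (inv≋ (k ℕ.+ suc d)) ⟨
    β ⊛ δ ⊛ (const (ι (suc k ℕ.+ suc d)) ⊛ α)
      ≈⟨ ≋.*-cong ≋.refl (≋.*-cong (≋.trans (const-cong (ι-+ (suc k) (suc d))) (const-+ (ι (suc k)) (ι (suc d)))) ≋.refl) ⟩
    β ⊛ δ ⊛ ((m ⊕ n) ⊛ α)
      ≈⟨ solve 5 (λ m n a b d → b :* d :* ((m :+ n) :* a) := a :* d :* (m :* b) :+ a :* b :* (n :* d)) ≋.refl m n α β δ ⟩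
    α ⊛ δ ⊛ (m ⊛ β) ⊕ α ⊛ β ⊛ (n ⊛ δ)
      ≈⟨ ≋.+-cong (≋.*-cong ≋.refl (inv≋ k)) (≋.*-cong ≋.refl (inv≋ d)) ⟩
    α ⊛ δ ⊛ (𝟙 ⊕ X ⊛ β) ⊕ α ⊛ β ⊛ (𝟙 ⊕ X ⊛ δ)
      ≈⟨ solve 4 (λ x a b d → a :* d :* (con 1 :+ x :* b) :+ a :* b :* (con 1 :+ x :* d)
                  := a :* (b :+ d :+ x :* b :* d) :+ x :* a :* b :* d) ≋.refl X α β δ ⟩
    α ⊛ (β ⊕ δ ⊕ X ⊛ β ⊛ δ) ⊕ X ⊛ α ⊛ β ⊛ δ ∎))
    where
    open PowerseriesSolver
    open SetoidReasoning ≋.setoid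
    α = inv (k ℕ.+ suc d)
    β = inv k
    δ = inv d
    m = const (ι (suc k))
    n = const (ι (suc d))

  -- The five series are treated as variables tied by two relations: the first is 1/α = 1/β + 1/δ +
  -- X cleared of denominators (`inv-+`), the second is `Λ-suc`, with l and l′ in the roles of `Λ k`
  -- and `Λ (suc k)`.
  telescope-core : ∀ {α β δ l l′} →
    α ⊛ (β ⊕ δ ⊕ X ⊛ β ⊛ δ) ≋ β ⊛ δ →
    (𝟙 ⊕ X ⊛ β) ⊛ l′ ⊕ β ≋ (𝟙 ⊕ X ⊛ β) ⊛ (l ⊕ β) →
    β ⊛ β ⊛ (l ⊕ β) ⊕ α ⊛ α ⊛ (𝟙 ⊕ X ⊛ β) ⊛ (𝟙 ⊕ X ⊛ δ) ⊛ (l′ ⊕ α) ⊕ β ⊛ β ⊛ (l ⊕ β) ⊛ (𝟙 ⊕ X ⊛ δ) ⊛ (X ⊛ α)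
    ≋ α ⊛ α ⊛ (l ⊕ α) ⊕ β ⊛ β ⊛ (l ⊕ β) ⊛ (𝟙 ⊕ X ⊛ δ)
  telescope-core {α} {β} {δ} {l} {l′} h₁ h₂ =
    -- Ideal membership: left minus right side is this cofactor times the defect of `h₁` plus α² (1
    -- + Xδ) times the defect of `h₂`.
    ⊕-cancel-multiple (X ⊛ (α ⊛ (l ⊕ β ⊕ α) ⊕ β ⊛ (l ⊕ β))) h₁
      (⊕-cancel-multiple (α ⊛ α ⊛ (𝟙 ⊕ X ⊛ δ)) h₂
        (solve 6 (λ x a b d l l′ →
            b :* b :* (l :+ b) :+ a :* a :* (con 1 :+ x :* b) :* (con 1 :+ x :* d) :* (l′ :+ a)
              :+ b :* b :* (l :+ b) :* (con 1 :+ x :* d) :* (x :* a)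
              :+ x :* (a :* (l :+ b :+ a) :+ b :* (l :+ b)) :* (b :* d)
              :+ a :* a :* (con 1 :+ x :* d) :* ((con 1 :+ x :* b) :* (l :+ b))
            := a :* a :* (l :+ a) :+ b :* b :* (l :+ b) :* (con 1 :+ x :* d)
              :+ x :* (a :* (l :+ b :+ a) :+ b :* (l :+ b)) :* (a :* (b :+ d :+ x :* b :* d))
              :+ a :* a :* (con 1 :+ x :* d) :* ((con 1 :+ x :* b) :* l′ :+ b))
          ≋.refl X α β δ l l′))
    where open PowerseriesSolver

  -- The sum with cutoff and its recurrence in N

  ∑< : (ℕ → Powerseries) → ℕ → Powerseries
  ∑< f zero    = 𝟘
  ∑< f (suc n) = ∑< f n ⊕ f n

  -- P k = ∏_{i≤k} i/(i - X) and Λ k = ∑_{i≤k} (1/(i - X) - 1/i)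

  P Λ : ℕ → Powerseries
  P zero    = 𝟙
  P (suc k) = P k ⊛ geo k
  Λ zero    = 𝟘
  Λ (suc k) = Λ k ⊕ const (u k) ⊛ (X ⊛ inv k)

  -- the part of the left-hand side with largest index k + 1 (see A-split and coeff-∑A)
  A : ℕ → Powerseries
  A k = P k ⊛ inv k ⊛ inv k ⊛ (Λ k ⊕ inv k)

  -- cutoff N k = ∏_{i<k} (N-i)/(N-i-X), and 0 if k > N
  cutoff : ℕ → ℕ → Powerseries
  cutoff N       zero    = 𝟙
  cutoff zero    (suc k) = 𝟘
  cutoff (suc N) (suc k) = geo N ⊛ cutoff N k

  -- geo′ d = d/(d - X)
  geo′ : ℕ → Powerseries
  geo′ zero    = 𝟘
  geo′ (suc d) = geo d

  cutoff-suc : ∀ k d → cutoff (k ℕ.+ d) (suc k) ≋ cutoff (k ℕ.+ d) k ⊛ geo′ d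
  cutoff-suc zero    zero    = ≋.sym (≋.*-identityˡ 𝟘)
  cutoff-suc zero    (suc d) = ≋.*-comm (geo d) 𝟙
  cutoff-suc (suc k) d       = ≋.trans (≋.*-cong ≋.refl (cutoff-suc k d))
    (≋.sym (≋.*-assoc (geo (k ℕ.+ d)) (cutoff (k ℕ.+ d) k) (geo′ d)))

  cutoff-beyond : ∀ k → cutoff k (suc k) ≋ 𝟘
  cutoff-beyond k = subst (λ n → cutoff n (suc k) ≋ 𝟘) (ℕ.+-identityʳ k)
    (≋.trans (cutoff-suc k 0) (≋.zeroʳ (cutoff (k ℕ.+ 0) k)))

  -- The increment of `Λ` is 1/(k+1-X) - 1/(k+1). Multiplying by `geo k` turns the subtracted
  -- 1/(k+1) into `inv k`, which is moved to the left.
  Λ-suc : ∀ k → geo k ⊛ Λ (suc k) ⊕ inv k ≋ geo k ⊛ (Λ k ⊕ inv k)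
  Λ-suc k = begin
    geo k ⊛ (Λ k ⊕ const (u k) ⊛ (X ⊛ inv k)) ⊕ inv k
      ≈⟨ solve 4 (λ q l c x → q :* (l :+ c :* (x :* (c :* q))) :+ c :* q := q :* l :+ (c :* q) :* (con 1 :+ x :* (c :* q)))
           ≋.refl (geo k) (Λ k) (const (u k)) X ⟩
    geo k ⊛ Λ k ⊕ inv k ⊛ (𝟙 ⊕ X ⊛ inv k)
      ≈⟨ ≋.+-cong ≋.refl (≋.trans (≋.*-comm _ _) (≋.*-cong (≋.sym (geo≋ k)) ≋.refl)) ⟩
    geo k ⊛ Λ k ⊕ geo k ⊛ inv k ≈⟨ ≋.distribˡ (geo k) (Λ k) (inv k) ⟨
    geo k ⊛ (Λ k ⊕ inv k) ∎
    where
    open PowerseriesSolver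
    open SetoidReasoning ≋.setoid

  -- One telescoping step with the common factors removed, where d is the distance from k to the end
  -- of the range. For d = 0 the factor `geo′ d` vanishes and `inv k` coincides with α; for d > 0
  -- this is `telescope-core`.
  bracket : ∀ k d {α l} → inv (k ℕ.+ d) ≋ α → geo k ⊛ l ⊕ inv k ≋ geo k ⊛ (Λ k ⊕ inv k) →
    inv k ⊛ inv k ⊛ (Λ k ⊕ inv k) ⊕ α ⊛ α ⊛ geo k ⊛ geo′ d ⊛ (l ⊕ α)
      ⊕ inv k ⊛ inv k ⊛ (Λ k ⊕ inv k) ⊛ geo′ d ⊛ (X ⊛ α)
    ≋ α ⊛ α ⊛ (Λ k ⊕ α) ⊕ inv k ⊛ inv k ⊛ (Λ k ⊕ inv k) ⊛ geo′ d
  bracket k zero {α} {l} α≋ h = begin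
    inv k ⊛ inv k ⊛ (Λ k ⊕ inv k) ⊕ α ⊛ α ⊛ geo k ⊛ 𝟘 ⊛ (l ⊕ α) ⊕ inv k ⊛ inv k ⊛ (Λ k ⊕ inv k) ⊛ 𝟘 ⊛ (X ⊛ α)
      ≈⟨ solve 6 (λ b a l l′ q x → b :* b :* (l :+ b) :+ a :* a :* q :* con 0 :* (l′ :+ a) :+ b :* b :* (l :+ b) :* con 0 :* (x :* a)
           := b :* b :* (l :+ b) :+ b :* b :* (l :+ b) :* con 0) ≋.refl (inv k) α (Λ k) l (geo k) X ⟩
    inv k ⊛ inv k ⊛ (Λ k ⊕ inv k) ⊕ inv k ⊛ inv k ⊛ (Λ k ⊕ inv k) ⊛ 𝟘
      ≈⟨ ≋.+-cong (≋.*-cong (≋.*-cong β≋ β≋) (≋.+-cong ≋.refl β≋)) ≋.refl ⟩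
    α ⊛ α ⊛ (Λ k ⊕ α) ⊕ inv k ⊛ inv k ⊛ (Λ k ⊕ inv k) ⊛ 𝟘 ∎
    where
    open PowerseriesSolver
    open SetoidReasoning ≋.setoid
    β≋ : inv k ≋ α
    β≋ = subst (λ n → inv n ≋ α) (ℕ.+-identityʳ k) α≋
  bracket k (suc d) {α} {l} α≋ h = begin
    β ⊛ β ⊛ (Λ k ⊕ β) ⊕ α ⊛ α ⊛ geo k ⊛ geo d ⊛ (l ⊕ α) ⊕ β ⊛ β ⊛ (Λ k ⊕ β) ⊛ geo d ⊛ (X ⊛ α)
      ≈⟨ ≋.+-cong (≋.+-cong ≋.refl (≋.*-cong (≋.*-cong (≋.*-cong ≋.refl (geo≋ k)) (geo≋ d)) ≋.refl))
                  (≋.*-cong (≋.*-cong ≋.refl (geo≋ d)) ≋.refl) ⟩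
    β ⊛ β ⊛ (Λ k ⊕ β) ⊕ α ⊛ α ⊛ (𝟙 ⊕ X ⊛ β) ⊛ (𝟙 ⊕ X ⊛ inv d) ⊛ (l ⊕ α)
      ⊕ β ⊛ β ⊛ (Λ k ⊕ β) ⊛ (𝟙 ⊕ X ⊛ inv d) ⊛ (X ⊛ α)
      ≈⟨ telescope-core {α} {β} {inv d} {Λ k} {l}
           (≋.trans (≋.*-cong (≋.sym α≋) ≋.refl) (inv-+ k d))
           (≋.trans (≋.+-cong (≋.*-cong (≋.sym (geo≋ k)) ≋.refl) ≋.refl) (≋.trans h (≋.*-cong (geo≋ k) ≋.refl))) ⟩
    α ⊛ α ⊛ (Λ k ⊕ α) ⊕ β ⊛ β ⊛ (Λ k ⊕ β) ⊛ (𝟙 ⊕ X ⊛ inv d)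
      ≈⟨ ≋.+-cong ≋.refl (≋.*-cong ≋.refl (≋.sym (geo≋ d))) ⟩
    α ⊛ α ⊛ (Λ k ⊕ α) ⊕ β ⊛ β ⊛ (Λ k ⊕ β) ⊛ geo d ∎
    where
    open SetoidReasoning ≋.setoid
    β = inv k

  S : ℕ → Powerseries
  S N = ∑< (λ k → A k ⊛ cutoff N (suc k)) N

  module Telescope (M : ℕ) where

    α = inv M

    -- The telescoping certificate: the k-th summand at `suc M`, minus 1 - X²α² times the one at
    -- `M`, equals Q k - Q (k+1). The lower end `Q 0` gives the inhomogeneous term α³ `geo M` of the
    -- recurrence; at k = M + 1 the cutoff makes `Q` vanish.
    Q : ℕ → Powerseries
    Q k = α ⊛ α ⊛ P k ⊛ cutoff (suc M) (suc k) ⊛ (Λ k ⊕ α)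

    step : ∀ k d → k ℕ.+ d ≡ M →
      A k ⊛ cutoff (suc M) (suc k) ⊕ Q (suc k) ⊕ X ⊛ X ⊛ (α ⊛ α) ⊛ (A k ⊛ cutoff M (suc k))
      ≋ Q k ⊕ A k ⊛ cutoff M (suc k)
    -- The added term replaces the factorisation 1 - X²α² = (1 - Xα)(1 + Xα). With it, both sides
    -- acquire the common factor `P k ⊛ Z ⊛ (𝟙 ⊕ X ⊛ α)`, whose last part is `geo M`.
    step k d refl = ⊕-cancelʳ (P k ⊛ Z ⊛ B ⊛ w ⊛ (X ⊛ α)) (begin
      P k ⊛ β ⊛ β ⊛ (Λ k ⊕ β) ⊛ (geo M ⊛ Z)
        ⊕ α ⊛ α ⊛ (P k ⊛ geo k) ⊛ (geo M ⊛ cutoff M (suc k)) ⊛ (l′ ⊕ α)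
        ⊕ X ⊛ X ⊛ (α ⊛ α) ⊛ (P k ⊛ β ⊛ β ⊛ (Λ k ⊕ β) ⊛ cutoff M (suc k))
        ⊕ P k ⊛ Z ⊛ B ⊛ w ⊛ (X ⊛ α)
        ≈⟨ ≋.+-cong (≋.+-cong (≋.+-cong (≋.*-cong ≋.refl (≋.*-cong (geo≋ M) ≋.refl))
                                        (≋.*-cong (≋.*-cong ≋.refl (≋.*-cong (geo≋ M) (cutoff-suc k d))) ≋.refl))
                              (≋.*-cong ≋.refl (≋.*-cong ≋.refl (cutoff-suc k d))))
                    ≋.refl ⟩
      P k ⊛ β ⊛ β ⊛ (Λ k ⊕ β) ⊛ ((𝟙 ⊕ X ⊛ α) ⊛ Z)
        ⊕ α ⊛ α ⊛ (P k ⊛ geo k) ⊛ ((𝟙 ⊕ X ⊛ α) ⊛ (Z ⊛ w)) ⊛ (l′ ⊕ α)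
        ⊕ X ⊛ X ⊛ (α ⊛ α) ⊛ (P k ⊛ β ⊛ β ⊛ (Λ k ⊕ β) ⊛ (Z ⊛ w))
        ⊕ P k ⊛ Z ⊛ B ⊛ w ⊛ (X ⊛ α)
        ≈⟨ solve 9 (λ x a b l l′ p q c w →
             p :* b :* b :* (l :+ b) :* ((con 1 :+ x :* a) :* c)
               :+ a :* a :* (p :* q) :* ((con 1 :+ x :* a) :* (c :* w)) :* (l′ :+ a)
               :+ x :* x :* (a :* a) :* (p :* b :* b :* (l :+ b) :* (c :* w))
               :+ p :* c :* (b :* b :* (l :+ b)) :* w :* (x :* a)
             := p :* c :* (con 1 :+ x :* a) :*
                  (b :* b :* (l :+ b) :+ a :* a :* q :* w :* (l′ :+ a) :+ b :* b :* (l :+ b) :* w :* (x :* a)))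
             ≋.refl X α β (Λ k) l′ (P k) (geo k) Z w ⟩
      P k ⊛ Z ⊛ (𝟙 ⊕ X ⊛ α) ⊛ (B ⊕ α ⊛ α ⊛ geo k ⊛ w ⊛ (l′ ⊕ α) ⊕ B ⊛ w ⊛ (X ⊛ α))
        ≈⟨ ≋.*-cong ≋.refl (bracket k d ≋.refl (Λ-suc k)) ⟩
      P k ⊛ Z ⊛ (𝟙 ⊕ X ⊛ α) ⊛ (α ⊛ α ⊛ (Λ k ⊕ α) ⊕ B ⊛ w)
        ≈⟨ solve 7 (λ x a b l p c w →
             p :* c :* (con 1 :+ x :* a) :* (a :* a :* (l :+ a) :+ b :* b :* (l :+ b) :* w)
             := a :* a :* p :* ((con 1 :+ x :* a) :* c) :* (l :+ a) :+ p :* b :* b :* (l :+ b) :* (c :* w)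
               :+ p :* c :* (b :* b :* (l :+ b)) :* w :* (x :* a))
             ≋.refl X α β (Λ k) (P k) Z w ⟩
      α ⊛ α ⊛ P k ⊛ ((𝟙 ⊕ X ⊛ α) ⊛ Z) ⊛ (Λ k ⊕ α) ⊕ P k ⊛ β ⊛ β ⊛ (Λ k ⊕ β) ⊛ (Z ⊛ w)
        ⊕ P k ⊛ Z ⊛ B ⊛ w ⊛ (X ⊛ α)
        ≈⟨ ≋.+-cong (≋.+-cong (≋.*-cong (≋.*-cong ≋.refl (≋.*-cong (geo≋ M) ≋.refl)) ≋.refl)
                              (≋.*-cong ≋.refl (cutoff-suc k d)))
                    ≋.refl ⟨
      α ⊛ α ⊛ P k ⊛ (geo M ⊛ Z) ⊛ (Λ k ⊕ α) ⊕ A k ⊛ cutoff M (suc k) ⊕ P k ⊛ Z ⊛ B ⊛ w ⊛ (X ⊛ α) ∎)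
      where
      open PowerseriesSolver
      open SetoidReasoning ≋.setoid
      β = inv k
      Z = cutoff M k
      w = geo′ d
      l′ = Λ (suc k)
      B = β ⊛ β ⊛ (Λ k ⊕ β)

    sum-step : ∀ k d → k ℕ.+ d ≡ suc M →
      ∑< (λ i → A i ⊛ cutoff (suc M) (suc i)) k ⊕ Q k ⊕ X ⊛ X ⊛ (α ⊛ α) ⊛ ∑< (λ i → A i ⊛ cutoff M (suc i)) k
      ≋ Q 0 ⊕ ∑< (λ i → A i ⊛ cutoff M (suc i)) k
    sum-step zero    d eq = solve 2 (λ q z → con 0 :+ q :+ z :* con 0 := q :+ con 0) ≋.refl (Q 0) (X ⊛ X ⊛ (α ⊛ α))
      where open PowerseriesSolver
    sum-step (suc k) d eq = ⊕-cancelʳ (Q k) (begin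
      s₁ ⊕ t₁ ⊕ Q (suc k) ⊕ z ⊛ (s₀ ⊕ t₀) ⊕ Q k
        ≈⟨ solve 7 (λ s₁ t₁ q′ z s₀ t₀ q → s₁ :+ t₁ :+ q′ :+ z :* (s₀ :+ t₀) :+ q := (s₁ :+ q :+ z :* s₀) :+ (t₁ :+ q′ :+ z :* t₀))
             ≋.refl s₁ t₁ (Q (suc k)) z s₀ t₀ (Q k) ⟩
      (s₁ ⊕ Q k ⊕ z ⊛ s₀) ⊕ (t₁ ⊕ Q (suc k) ⊕ z ⊛ t₀)
        ≈⟨ ≋.+-cong (sum-step k (suc d) (trans (ℕ.+-suc k d) eq)) (step k d (ℕ.suc-injective eq)) ⟩
      (Q 0 ⊕ s₀) ⊕ (Q k ⊕ t₀)
        ≈⟨ solve 4 (λ q₀ s q t → (q₀ :+ s) :+ (q :+ t) := q₀ :+ (s :+ t) :+ q) ≋.refl (Q 0) s₀ (Q k) t₀ ⟩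
      Q 0 ⊕ (s₀ ⊕ t₀) ⊕ Q k ∎)
      where
      open PowerseriesSolver
      open SetoidReasoning ≋.setoid
      z  = X ⊛ X ⊛ (α ⊛ α)
      s₀ = ∑< (λ i → A i ⊛ cutoff M (suc i)) k
      s₁ = ∑< (λ i → A i ⊛ cutoff (suc M) (suc i)) k
      t₀ = A k ⊛ cutoff M (suc k)
      t₁ = A k ⊛ cutoff (suc M) (suc k)

    S-suc : S (suc M) ⊕ X ⊛ X ⊛ (S M ⊛ (α ⊛ α)) ≋ S M ⊕ α ⊛ α ⊛ α ⊛ geo M
    S-suc = begin
      S (suc M) ⊕ X ⊛ X ⊛ (S M ⊛ (α ⊛ α))
        -- A zero is inserted, to be read as the upper end `Q (suc M)`.
        ≈⟨ solve 6 (λ s x s₀ a p l → s :+ x :* x :* (s₀ :* (a :* a))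
                    := s :+ a :* a :* p :* con 0 :* (l :+ a) :+ x :* x :* (a :* a) :* s₀)
             ≋.refl (S (suc M)) X (S M) α (P (suc M)) (Λ (suc M)) ⟩
      S (suc M) ⊕ α ⊛ α ⊛ P (suc M) ⊛ 𝟘 ⊛ (Λ (suc M) ⊕ α) ⊕ X ⊛ X ⊛ (α ⊛ α) ⊛ S M
        ≈⟨ ≋.+-cong (≋.+-cong ≋.refl (≋.*-cong (≋.*-cong ≋.refl (≋.sym (cutoff-beyond (suc M)))) ≋.refl)) (≋.*-cong ≋.refl (≋.sym ∑≋S)) ⟩
      S (suc M) ⊕ Q (suc M) ⊕ X ⊛ X ⊛ (α ⊛ α) ⊛ ∑< (λ i → A i ⊛ cutoff M (suc i)) (suc M)
        ≈⟨ sum-step (suc M) 0 (ℕ.+-identityʳ (suc M)) ⟩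
      Q 0 ⊕ ∑< (λ i → A i ⊛ cutoff M (suc i)) (suc M)
        ≈⟨ ≋.+-cong ≋.refl ∑≋S ⟩
      α ⊛ α ⊛ 𝟙 ⊛ (geo M ⊛ 𝟙) ⊛ (𝟘 ⊕ α) ⊕ S M
        ≈⟨ solve 3 (λ a q s → a :* a :* con 1 :* (q :* con 1) :* (con 0 :+ a) :+ s := s :+ a :* a :* a :* q) ≋.refl α (geo M) (S M) ⟩
      S M ⊕ α ⊛ α ⊛ α ⊛ geo M ∎
      where
      open PowerseriesSolver
      open SetoidReasoning ≋.setoid
      -- At level `M` the range has one summand more than `S M`, and its cutoff is zero.
      ∑≋S : ∑< (λ i → A i ⊛ cutoff M (suc i)) (suc M) ≋ S M
      ∑≋S = ≋.trans (≋.+-cong ≋.refl (≋.trans (≋.*-cong ≋.refl (cutoff-beyond M)) (≋.zeroʳ (A M)))) (≋.+-identityʳ (S M))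

  -- Expansion of the recurrence into nested sums

  -- (-X²)^j T j N are the terms of the right-hand side with j + 1 indices, and U j N = ∑_i (-X²)^i T (j + i) N

  U T : ℕ → ℕ → Powerseries
  U zero    N = S N
  U (suc j) N = ∑< (λ k → U j k ⊛ (inv k ⊛ inv k)) N
  T zero    N = ∑< (λ k → inv k ⊛ inv k ⊛ inv k ⊛ geo k) N
  T (suc j) N = ∑< (λ k → T j k ⊛ (inv k ⊛ inv k)) N

  -- For j = 0, `S-suc` says that the increment of `S` is that of `T 0` minus X² times that of
  -- `U 1`. The operator that sums against `inv k ⊛ inv k` is linear and carries the relation from j
  -- to j + 1.
  U-split : ∀ j N → U j N ⊕ X ⊛ X ⊛ U (suc j) N ≋ T j N
  U-split zero    zero    = solve 1 (λ z → con 0 :+ z :* con 0 := con 0) ≋.refl (X ⊛ X)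
    where open PowerseriesSolver
  U-split zero    (suc N) = ⊕-cancelʳ (S N) (begin
    S (suc N) ⊕ z ⊛ (U 1 N ⊕ t) ⊕ S N
      ≈⟨ solve 5 (λ s z u t s₀ → s :+ z :* (u :+ t) :+ s₀ := (s₀ :+ z :* u) :+ (s :+ z :* t)) ≋.refl (S (suc N)) z (U 1 N) t (S N) ⟩
    (S N ⊕ z ⊛ U 1 N) ⊕ (S (suc N) ⊕ z ⊛ t)
      ≈⟨ ≋.+-cong (U-split zero N) (Telescope.S-suc N) ⟩
    T 0 N ⊕ (S N ⊕ a)
      ≈⟨ solve 3 (λ t s a → t :+ (s :+ a) := t :+ a :+ s) ≋.refl (T 0 N) (S N) a ⟩
    T 0 N ⊕ a ⊕ S N ∎)
    where
    open PowerseriesSolver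
    open SetoidReasoning ≋.setoid
    z = X ⊛ X
    t = S N ⊛ (inv N ⊛ inv N)
    a = inv N ⊛ inv N ⊛ inv N ⊛ geo N
  U-split (suc j) zero    = solve 1 (λ z → con 0 :+ z :* con 0 := con 0) ≋.refl (X ⊛ X)
    where open PowerseriesSolver
  U-split (suc j) (suc N) = begin
    U (suc j) N ⊕ U j N ⊛ a ⊕ z ⊛ (U (suc (suc j)) N ⊕ U (suc j) N ⊛ a)
      ≈⟨ solve 5 (λ u₁ u₀ a z u₂ → u₁ :+ u₀ :* a :+ z :* (u₂ :+ u₁ :* a) := (u₁ :+ z :* u₂) :+ (u₀ :+ z :* u₁) :* a)
           ≋.refl (U (suc j) N) (U j N) a z (U (suc (suc j)) N) ⟩
    (U (suc j) N ⊕ z ⊛ U (suc (suc j)) N) ⊕ (U j N ⊕ z ⊛ U (suc j) N) ⊛ a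
      ≈⟨ ≋.+-cong (U-split (suc j) N) (≋.*-cong (U-split j N) ≋.refl) ⟩
    T (suc j) N ⊕ T j N ⊛ a ∎
    where
    open PowerseriesSolver
    open SetoidReasoning ≋.setoid
    z = X ⊛ X
    a = inv N ⊛ inv N

  -- Sums over lists and tuples

  ∑ˡ : ∀ {B : Set} → List B → (B → ℚ) → ℚ
  ∑ˡ xs f = foldr (λ a s → f a + s) 0ℚ xs

  seq-∑ : ∀ {B : Set} (xs : List B) (f : B → ℝ) N → seq (∑ xs f) N ≡ ∑ˡ xs (λ a → seq (f a) N)
  seq-∑ []       f N = refl
  seq-∑ (x ∷ xs) f N = cong (seq (f x) N +_) (seq-∑ xs f N)

  ∑ˡ-cong : ∀ {B : Set} (xs : List B) {f g} → (∀ a → f a ≡ g a) → ∑ˡ xs f ≡ ∑ˡ xs g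
  ∑ˡ-cong []       h = refl
  ∑ˡ-cong (x ∷ xs) h = cong₂ _+_ (h x) (∑ˡ-cong xs h)

  ∑ˡ-+ : ∀ {B : Set} (xs : List B) f g → ∑ˡ xs (λ a → f a + g a) ≡ ∑ˡ xs f + ∑ˡ xs g
  ∑ˡ-+ []       f g = refl
  ∑ˡ-+ (x ∷ xs) f g = trans (cong (f x + g x +_) (∑ˡ-+ xs f g))
    (solve 4 (λ a b c d → (a :+ b) :+ (c :+ d) := (a :+ c) :+ (b :+ d)) refl (f x) (g x) (∑ˡ xs f) (∑ˡ xs g))
    where open +-*-Solver

  ∑ˡ-*ʳ : ∀ {B : Set} (xs : List B) f c → ∑ˡ xs (λ a → f a * c) ≡ ∑ˡ xs f * c
  ∑ˡ-*ʳ []       f c = sym (ℚ.*-zeroˡ c)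
  ∑ˡ-*ʳ (x ∷ xs) f c = trans (cong (f x * c +_) (∑ˡ-*ʳ xs f c)) (sym (ℚ.*-distribʳ-+ c (f x) (∑ˡ xs f)))

  ∑ˡ-zero : ∀ {B : Set} (xs : List B) → ∑ˡ xs (λ _ → 0ℚ) ≡ 0ℚ
  ∑ˡ-zero []       = refl
  ∑ˡ-zero (x ∷ xs) = trans (ℚ.+-identityˡ _) (∑ˡ-zero xs)

  ∑ˡ-++ : ∀ {B : Set} (xs ys : List B) f → ∑ˡ (xs ++ ys) f ≡ ∑ˡ xs f + ∑ˡ ys f
  ∑ˡ-++ []       ys f = sym (ℚ.+-identityˡ _)
  ∑ˡ-++ (x ∷ xs) ys f = trans (cong (f x +_) (∑ˡ-++ xs ys f)) (sym (ℚ.+-assoc (f x) (∑ˡ xs f) (∑ˡ ys f)))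

  ∑ˡ-map : ∀ {B B′ : Set} (g : B → B′) xs f → ∑ˡ (map g xs) f ≡ ∑ˡ xs (λ a → f (g a))
  ∑ˡ-map g []       f = refl
  ∑ˡ-map g (x ∷ xs) f = cong (f (g x) +_) (∑ˡ-map g xs f)

  ∑ˡ-concatMap : ∀ {B B′ : Set} (g : B → List B′) xs f → ∑ˡ (concatMap g xs) f ≡ ∑ˡ xs (λ a → ∑ˡ (g a) f)
  ∑ˡ-concatMap g []       f = refl
  ∑ˡ-concatMap g (x ∷ xs) f = trans (∑ˡ-++ (g x) (concatMap g xs) f) (cong (∑ˡ (g x) f +_) (∑ˡ-concatMap g xs f))

  ∑ˡ-splits : ∀ m (f : ℕ × ℕ → ℚ) → ∑ˡ (splits m) f ≡ diag (λ p q → f (p , q)) m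
  ∑ˡ-splits m f = go m (λ p → p)
    where
    go : ∀ m (g : ℕ → ℕ) → ∑ˡ (applyUpTo (λ p → g p , m ℕ.∸ p) (suc m)) f ≡ diag (λ p q → f (g p , q)) m
    go zero    g = ℚ.+-identityʳ _
    go (suc m) g = cong (f (g 0 , suc m) +_) (go m (λ p → g (suc p)))

  tuples-∷ : ∀ k m (F : Vec ℕ (suc k) → ℚ) →
    ∑ˡ (tuples (suc k) m) F ≡ diag (λ c r → ∑ˡ (tuples k r) (λ d → F (c ∷ d))) m
  tuples-∷ k m F = trans (∑ˡ-concatMap (λ (c , d) → map (c ∷_) (tuples k d)) (splits m) F)
    (trans (∑ˡ-splits m _) (diag-cong (λ c r → ∑ˡ-map (c ∷_) (tuples k r) F) m))

  -- The enumeration starts from the first entry, but the last one belongs to the largest summation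
  -- index, the one that changes when N grows.
  tuples-∷ʳ : ∀ k m (F : Vec ℕ (suc k) → ℚ) →
    ∑ˡ (tuples (suc k) m) F ≡ diag (λ s b → ∑ˡ (tuples k s) (λ d → F (d ∷ʳ b))) m
  tuples-∷ʳ zero m F = trans (tuples-∷ 0 m F) (trans (diag-flip _ m) (diag-cong (λ { zero b → refl ; (suc s) b → refl }) m))
  tuples-∷ʳ (suc k) m F = begin
    ∑ˡ (tuples (suc (suc k)) m) F ≡⟨ tuples-∷ (suc k) m F ⟩
    diag (λ c r → ∑ˡ (tuples (suc k) r) (λ d → F (c ∷ d))) m
      ≡⟨ diag-cong (λ c r → tuples-∷ʳ k r (λ d → F (c ∷ d))) m ⟩
    diag (λ c r → diag (λ s b → ∑ˡ (tuples k s) (λ d → F (c ∷ (d ∷ʳ b)))) r) m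
      ≡⟨ diag-assoc (λ c s b → ∑ˡ (tuples k s) (λ d → F (c ∷ (d ∷ʳ b)))) m ⟨
    diag (λ t b → diag (λ c s → ∑ˡ (tuples k s) (λ d → F (c ∷ (d ∷ʳ b)))) t) m
      ≡⟨ diag-cong (λ t b → tuples-∷ k t (λ d → F (d ∷ʳ b))) m ⟨
    diag (λ t b → ∑ˡ (tuples (suc k) t) (λ d → F (d ∷ʳ b))) m ∎
    where open ≡-Reasoning

  toList-∷ʳ-shift : ∀ {j} (cs : Vec ℕ j) b a → map (ℕ._+ a) (toList (cs ∷ʳ b)) ≡ map (ℕ._+ a) (toList cs) ++ [ b ℕ.+ a ]
  toList-∷ʳ-shift cs b a = trans (cong (map (ℕ._+ a)) (toList-∷ʳ b cs)) (map-++ (ℕ._+ a) (toList cs) [ b ])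

  reverse-shift-∷ʳ : ∀ {j} (c : Vec ℕ (suc j)) b → reverse (shift (c ∷ʳ b)) ≡ (b ℕ.+ 2) ∷ reverse (shift c)
  reverse-shift-∷ʳ (c₀ ∷ cs) b = trans (cong (λ l → reverse (c₀ ℕ.+ 3 ∷ l)) (toList-∷ʳ-shift cs b 2))
    (reverse-++ (shift (c₀ ∷ cs)) [ b ℕ.+ 2 ])

  W-∷ʳ : ∀ {j} (c : Vec ℕ (suc j)) b → W (c ∷ʳ b) ≡ W c ℕ.* (b ℕ.+ 1)
  W-∷ʳ (c₀ ∷ cs) b = trans
    (cong (((c₀ ℕ.+ 3) C 3) ℕ.*_) (trans (cong product (toList-∷ʳ-shift cs b 1))
      (trans (product-++ (map (ℕ._+ 1) (toList cs)) [ b ℕ.+ 1 ]) (cong (product (map (ℕ._+ 1) (toList cs)) ℕ.*_) (ℕ.*-identityʳ (b ℕ.+ 1))))))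
    (sym (ℕ.*-assoc ((c₀ ℕ.+ 3) C 3) _ (b ℕ.+ 1)))

  -- Coefficients of the right-hand side

  ^⁻≡^ : ∀ k a → suc k ^⁻ a ≡ u k ^ℚ a
  ^⁻≡^ k zero    = refl
  ^⁻≡^ k (suc a) = trans (1/* (suc k) (suc k ℕ.^ a) {{_}} {{ℕ.m^n≢0 (suc k) a}} {{ℕ.m^n≢0 (suc k) (suc a)}}) (cong (u k *_) (^⁻≡^ k a))
    where
    1/* : ∀ m n .{{_ : ℕ.NonZero m}} .{{_ : ℕ.NonZero n}} .{{_ : ℕ.NonZero (m ℕ.* n)}} → ℤ.+ 1 / (m ℕ.* n) ≡ (ℤ.+ 1 / m) * (ℤ.+ 1 / n)
    1/* (suc m) (suc n) = sym (/-* (ℤ.+ 1) m (ℤ.+ 1) n)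

  coeff-geo-⊛ : ∀ k f m → coeff (geo k ⊛ f) (suc m) ≡ coeff f (suc m) + u k * coeff (geo k ⊛ f) m
  coeff-geo-⊛ k f m = trans (coeff≡ eq (suc m)) (cong (coeff f (suc m) +_)
    (trans (coeff-X (const (u k) ⊛ (geo k ⊛ f)) (suc m)) (coeff-const (u k) (geo k ⊛ f) m)))
    where
    open PowerseriesSolver
    eq : geo k ⊛ f ≋ f ⊕ X ⊛ (const (u k) ⊛ (geo k ⊛ f))
    eq = ≋.trans (≋.*-cong (geo≋ k) ≋.refl)
      (solve 4 (λ x c q f → (con 1 :+ x :* (c :* q)) :* f := f :+ x :* (c :* (q :* f))) ≋.refl X (const (u k)) (geo k) f)

  geo^ : ℕ → ℕ → Powerseries
  geo^ k zero    = geo k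
  geo^ k (suc r) = geo k ⊛ geo^ k r

  -- The negative binomial series: `geo^ k r` has r + 1 factors, and the recursion `coeff-geo-⊛`
  -- becomes Pascal's rule.
  coeff-geo^ : ∀ k r m → coeff (geo^ k r) m ≡ ι ((m ℕ.+ r) C r) * u k ^ℚ m
  coeff-geo^ k zero    m       = sym (ℚ.*-identityˡ _)
  coeff-geo^ k (suc r) zero    = trans (ℚ.*-identityˡ _) (trans (coeff-geo^ k r 0)
    (cong (λ n → ι n * 1ℚ) (trans (nCn≡1 r) (sym (nCn≡1 (suc r))))))
  coeff-geo^ k (suc r) (suc m) = begin
    coeff (geo^ k (suc r)) (suc m) ≡⟨ coeff-geo-⊛ k (geo^ k r) m ⟩
    coeff (geo^ k r) (suc m) + u k * coeff (geo^ k (suc r)) m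
      ≡⟨ cong₂ (λ a b → a + u k * b) (coeff-geo^ k r (suc m)) (coeff-geo^ k (suc r) m) ⟩
    ι ((suc m ℕ.+ r) C r) * (u k * u k ^ℚ m) + u k * (ι ((m ℕ.+ suc r) C suc r) * u k ^ℚ m)
      ≡⟨ solve 4 (λ a b u x → a :* (u :* x) :+ u :* (b :* x) := (a :+ b) :* (u :* x)) refl
           (ι ((suc m ℕ.+ r) C r)) (ι ((m ℕ.+ suc r) C suc r)) (u k) (u k ^ℚ m) ⟩
    (ι ((suc m ℕ.+ r) C r) + ι ((m ℕ.+ suc r) C suc r)) * u k ^ℚ suc m
      ≡⟨ cong (_* u k ^ℚ suc m) (trans (sym (ι-+ ((suc m ℕ.+ r) C r) ((m ℕ.+ suc r) C suc r)))
           (cong ι (trans (cong (λ n → (n C r) ℕ.+ ((m ℕ.+ suc r) C suc r)) (sym (ℕ.+-suc m r)))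
             (nCk+nC[k+1]≡[n+1]C[k+1] (m ℕ.+ suc r) r)))) ⟩
    ι ((suc m ℕ.+ suc r) C suc r) * u k ^ℚ suc m ∎
    where
    open ≡-Reasoning
    open +-*-Solver

  coeff-const-* : ∀ k a r m →
    coeff (const (u k ^ℚ a) ⊛ geo^ k r) m ≡ ι ((m ℕ.+ r) C r) * suc k ^⁻ (m ℕ.+ a)
  coeff-const-* k a r m = begin
    coeff (const (u k ^ℚ a) ⊛ geo^ k r) m ≡⟨ coeff-const (u k ^ℚ a) (geo^ k r) m ⟩
    u k ^ℚ a * coeff (geo^ k r) m ≡⟨ cong (u k ^ℚ a *_) (coeff-geo^ k r m) ⟩
    u k ^ℚ a * (ι ((m ℕ.+ r) C r) * u k ^ℚ m)
      ≡⟨ solve 3 (λ a b c → a :* (b :* c) := b :* (c :* a)) refl (u k ^ℚ a) (ι ((m ℕ.+ r) C r)) (u k ^ℚ m) ⟩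
    ι ((m ℕ.+ r) C r) * (u k ^ℚ m * u k ^ℚ a)
      ≡⟨ cong (ι ((m ℕ.+ r) C r) *_) (trans (sym (^-+ (u k) m a)) (sym (^⁻≡^ k (m ℕ.+ a)))) ⟩
    ι ((m ℕ.+ r) C r) * suc k ^⁻ (m ℕ.+ a) ∎
    where
    open ≡-Reasoning
    open +-*-Solver

  coeff-inv² : ∀ k m → coeff (inv k ⊛ inv k) m ≡ ι (m ℕ.+ 1) * suc k ^⁻ (m ℕ.+ 2)
  coeff-inv² k m = trans (coeff≡ eq m) (trans (coeff-const-* k 2 1 m)
    (cong (λ n → ι n * suc k ^⁻ (m ℕ.+ 2)) (nC1≡n (m ℕ.+ 1))))
    where
    open PowerseriesSolver
    c = const (u k)
    c² : const (u k ^ℚ 2) ≋ c ⊛ c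
    c² = ≋.trans (const-cong (cong (u k *_) (ℚ.*-identityʳ (u k)))) (const-* (u k) (u k))
    eq : inv k ⊛ inv k ≋ const (u k ^ℚ 2) ⊛ geo^ k 1
    eq = ≋.trans (solve 2 (λ c q → (c :* q) :* (c :* q) := c :* c :* (q :* q)) ≋.refl c (geo k))
      (≋.*-cong (≋.sym c²) ≋.refl)

  coeff-inv³geo : ∀ k m → coeff (inv k ⊛ inv k ⊛ inv k ⊛ geo k) m ≡ ι ((m ℕ.+ 3) C 3) * suc k ^⁻ (m ℕ.+ 3)
  coeff-inv³geo k m = trans (coeff≡ eq m) (coeff-const-* k 3 3 m)
    where
    open PowerseriesSolver
    c = const (u k)
    c³ : const (u k ^ℚ 3) ≋ c ⊛ (c ⊛ (c ⊛ 𝟙))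
    c³ = ≋.trans (const-* (u k) (u k ^ℚ 2)) (≋.*-cong ≋.refl
      (≋.trans (const-* (u k) (u k ^ℚ 1)) (≋.*-cong ≋.refl (const-* (u k) 1ℚ))))
    eq : inv k ⊛ inv k ⊛ inv k ⊛ geo k ≋ const (u k ^ℚ 3) ⊛ geo^ k 3
    eq = ≋.trans (solve 2 (λ c q → (c :* q) :* (c :* q) :* (c :* q) :* q := c :* (c :* (c :* con 1)) :* (q :* (q :* (q :* q)))) ≋.refl c (geo k))
      (≋.*-cong (≋.sym c³) ≋.refl)

  weighted : ∀ {j} → ℕ → Vec ℕ (suc j) → ℚ
  weighted N c = ι (W c) * nested pred (reverse (shift c)) N

  -- the N-th approximation of the j-th summand of the right-hand side, without its sign
  summand : ℕ → ℕ → ℕ → ℚ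
  summand j N m = ∑ˡ (tuples (suc j) m) (weighted N)

  coeff-𝟘 : ∀ m → coeff 𝟘 m ≡ 0ℚ
  coeff-𝟘 zero    = refl
  coeff-𝟘 (suc m) = refl

  summand₀ : ∀ N m → summand 0 N m ≡ ι ((m ℕ.+ 3) C 3) * nested pred [ m ℕ.+ 3 ] N
  summand₀ N m = trans (tuples-∷ 0 m (weighted N)) (trans (diag-head _ m (λ p q → refl)) (trans (ℚ.+-identityʳ _)
    (cong (λ n → ι n * nested pred [ m ℕ.+ 3 ] N) (ℕ.*-identityʳ ((m ℕ.+ 3) C 3)))))

  summand-∷ʳ : ∀ j N m → summand (suc j) N m ≡
    diag (λ s b → ∑ˡ (tuples (suc j) s) (λ d → ι (W d ℕ.* (b ℕ.+ 1)) * nested pred ((b ℕ.+ 2) ∷ reverse (shift d)) N)) m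
  summand-∷ʳ j N m = trans (tuples-∷ʳ (suc j) m (weighted N)) (diag-cong (λ s b → ∑ˡ-cong (tuples (suc j) s) (λ d →
    cong₂ (λ w l → ι w * nested pred l N) (W-∷ʳ d b) (reverse-shift-∷ʳ d b))) m)

  summand-zero : ∀ j m → summand j 0 m ≡ 0ℚ
  summand-zero zero    m = trans (summand₀ 0 m) (ℚ.*-zeroʳ (ι ((m ℕ.+ 3) C 3)))
  summand-zero (suc j) m = trans (summand-∷ʳ j 0 m) (trans (diag-cong (λ s b → trans
    (∑ˡ-cong (tuples (suc j) s) (λ d → ℚ.*-zeroʳ (ι (W d ℕ.* (b ℕ.+ 1))))) (∑ˡ-zero (tuples (suc j) s))) m) (diag-zero m))

  summand-suc : ∀ j N m → summand (suc j) (suc N) m ≡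
    summand (suc j) N m + diag (λ s b → summand j N s * (ι (b ℕ.+ 1) * suc N ^⁻ (b ℕ.+ 2))) m
  summand-suc j N m = begin
    summand (suc j) (suc N) m ≡⟨ summand-∷ʳ j (suc N) m ⟩
    diag (λ s b → ∑ˡ (tuples (suc j) s) (λ d → w d b * (z d b + x b * y′ d))) m
      ≡⟨ diag-cong (λ s b → ∑ˡ-cong (tuples (suc j) s) (λ d → split (W d) b (z d b) (x b) (y′ d))) m ⟩
    diag (λ s b → ∑ˡ (tuples (suc j) s) (λ d → w d b * z d b + ι (W d) * y′ d * (ι (b ℕ.+ 1) * x b))) m
      ≡⟨ diag-cong (λ s b → trans (∑ˡ-+ (tuples (suc j) s) (λ d → w d b * z d b) (λ d → ι (W d) * y′ d * (ι (b ℕ.+ 1) * x b)))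
           (cong (∑ˡ (tuples (suc j) s) (λ d → w d b * z d b) +_) (∑ˡ-*ʳ (tuples (suc j) s) (λ d → ι (W d) * y′ d) (ι (b ℕ.+ 1) * x b)))) m ⟩
    diag (λ s b → ∑ˡ (tuples (suc j) s) (λ d → w d b * z d b) + summand j N s * (ι (b ℕ.+ 1) * x b)) m
      ≡⟨ diag-+ (λ s b → ∑ˡ (tuples (suc j) s) (λ d → w d b * z d b)) _ m ⟩
    diag (λ s b → ∑ˡ (tuples (suc j) s) (λ d → w d b * z d b)) m + diag (λ s b → summand j N s * (ι (b ℕ.+ 1) * x b)) m
      ≡⟨ cong (_+ diag (λ s b → summand j N s * (ι (b ℕ.+ 1) * x b)) m) (summand-∷ʳ j N m) ⟨
    summand (suc j) N m + diag (λ s b → summand j N s * (ι (b ℕ.+ 1) * x b)) m ∎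
    where
    open ≡-Reasoning
    w : Vec ℕ (suc j) → ℕ → ℚ
    w d b = ι (W d ℕ.* (b ℕ.+ 1))
    z : Vec ℕ (suc j) → ℕ → ℚ
    z d b = nested pred ((b ℕ.+ 2) ∷ reverse (shift d)) N
    x : ℕ → ℚ
    x b = suc N ^⁻ (b ℕ.+ 2)
    y′ : Vec ℕ (suc j) → ℚ
    y′ d = nested pred (reverse (shift d)) N
    split : ∀ c b z x y → ι (c ℕ.* (b ℕ.+ 1)) * (z + x * y) ≡ ι (c ℕ.* (b ℕ.+ 1)) * z + ι c * y * (ι (b ℕ.+ 1) * x)
    split c b z x y = trans (cong (_* (z + x * y)) (ι-* c (b ℕ.+ 1)))
      (trans (solve 5 (λ c b z x y → c :* b :* (z :+ x :* y) := c :* b :* z :+ c :* y :* (b :* x)) refl (ι c) (ι (b ℕ.+ 1)) z x y)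
        (cong (λ a → a * z + ι c * y * (ι (b ℕ.+ 1) * x)) (sym (ι-* c (b ℕ.+ 1)))))
      where open +-*-Solver

  coeff-T : ∀ j N m → coeff (T j N) m ≡ summand j N m
  coeff-T zero    zero    m = trans (coeff-𝟘 m) (sym (summand-zero 0 m))
  coeff-T (suc j) zero    m = trans (coeff-𝟘 m) (sym (summand-zero (suc j) m))
  coeff-T zero    (suc N) m = begin
    coeff (T 0 N) m + coeff (inv N ⊛ inv N ⊛ inv N ⊛ geo N) m
      ≡⟨ cong₂ _+_ (trans (coeff-T 0 N m) (summand₀ N m)) (coeff-inv³geo N m) ⟩
    c * nested pred [ m ℕ.+ 3 ] N + c * suc N ^⁻ (m ℕ.+ 3)
      ≡⟨ solve 3 (λ c a b → c :* a :+ c :* b := c :* (a :+ b :* con 1ℚ)) refl c (nested pred [ m ℕ.+ 3 ] N) (suc N ^⁻ (m ℕ.+ 3)) ⟩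
    c * nested pred [ m ℕ.+ 3 ] (suc N) ≡⟨ summand₀ (suc N) m ⟨
    summand 0 (suc N) m ∎
    where
    open ≡-Reasoning
    open +-*-Solver
    c = ι ((m ℕ.+ 3) C 3)
  coeff-T (suc j) (suc N) m = trans
    (cong₂ _+_ (coeff-T (suc j) N m) (diag-cong (λ s b → cong₂ _*_ (coeff-T j N s) (coeff-inv² N b)) m))
    (sym (summand-suc j N m))

  -- The alternating sum in odd degree

  sign : ℕ → ℚ
  sign j = (-1ℤ ℤ.^ j) / 1

  sign-suc : ∀ j q → sign (suc j) * q ≡ - (sign j * q)
  sign-suc j q = trans (cong (_* q) (sym (/-* -1ℤ 0 (-1ℤ ℤ.^ j) 0)))
    (solve 2 (λ s q → con (- 1ℚ) :* s :* q := :- (s :* q)) refl (sign j) q)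
    where open +-*-Solver

  ∑ⁿ : ℕ → (ℕ → ℚ) → ℚ
  ∑ⁿ zero    f = 0ℚ
  ∑ⁿ (suc n) f = f 0 + ∑ⁿ n (λ i → f (suc i))

  ∑ⁿ-cong : ∀ n {f g} → (∀ i → f i ≡ g i) → ∑ⁿ n f ≡ ∑ⁿ n g
  ∑ⁿ-cong zero    h = refl
  ∑ⁿ-cong (suc n) h = cong₂ _+_ (h 0) (∑ⁿ-cong n (λ i → h (suc i)))

  ∑ⁿ-neg : ∀ n f → ∑ⁿ n (λ i → - f i) ≡ - ∑ⁿ n f
  ∑ⁿ-neg zero    f = refl
  ∑ⁿ-neg (suc n) f = trans (cong (λ a → - f 0 + a) (∑ⁿ-neg n (λ i → f (suc i)))) (sym (ℚ.neg-distrib-+ (f 0) _))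

  ∑ˡ-applyUpTo : ∀ (g : ℕ → ℕ) n f → ∑ˡ (applyUpTo g n) f ≡ ∑ⁿ n (λ i → f (g i))
  ∑ˡ-applyUpTo g zero    f = refl
  ∑ˡ-applyUpTo g (suc n) f = cong (f (g 0) +_) (∑ˡ-applyUpTo (λ i → g (suc i)) n f)

  coeff-X² : ∀ f m → coeff (X ⊛ X ⊛ f) (suc (suc m)) ≡ coeff f m
  coeff-X² f m = trans (coeff≡ (≋.*-assoc X X f) (suc (suc m))) (trans (coeff-X (X ⊛ f) (suc (suc m))) (coeff-X f (suc m)))

  coeff-X²₁ : ∀ f → coeff (X ⊛ X ⊛ f) 1 ≡ 0ℚ
  coeff-X²₁ f = trans (coeff≡ (≋.*-assoc X X f) 1) (trans (coeff-X (X ⊛ f) 1) (coeff-X f 0))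

  -- `U-split` is solved for `U j` repeatedly, lowering the degree by two each time. It stops in
  -- degree 1, where the multiple of X² has no coefficient.
  coeff-U : ∀ n j N → coeff (U j N) (2 ℕ.* n ℕ.+ 1) ≡
    ∑ⁿ (suc n) (λ i → sign i * coeff (T (j ℕ.+ i) N) (2 ℕ.* n ℕ.+ 1 ℕ.∸ 2 ℕ.* i))
  coeff-U zero j N = begin
    coeff (U j N) 1 ≡⟨ ℚ.+-identityʳ _ ⟨
    coeff (U j N) 1 + 0ℚ ≡⟨ cong (coeff (U j N) 1 +_) (coeff-X²₁ (U (suc j) N)) ⟨
    coeff (U j N) 1 + coeff (X ⊛ X ⊛ U (suc j) N) 1 ≡⟨ coeff≡ (U-split j N) 1 ⟩
    coeff (T j N) 1 ≡⟨ cong (λ i → coeff (T i N) 1) (ℕ.+-identityʳ j) ⟨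
    coeff (T (j ℕ.+ 0) N) 1 ≡⟨ solve 1 (λ a → con 1ℚ :* a :+ con 0ℚ := a) refl (coeff (T (j ℕ.+ 0) N) 1) ⟨
    1ℚ * coeff (T (j ℕ.+ 0) N) 1 + 0ℚ ∎
    where
    open ≡-Reasoning
    open +-*-Solver
  coeff-U (suc n) j N = begin
    coeff (U j N) (2 ℕ.* suc n ℕ.+ 1) ≡⟨ cong (coeff (U j N)) m≡ ⟩
    coeff (U j N) (suc (suc m))
      ≡⟨ solve 2 (λ a b → a := a :+ b :- b) refl (coeff (U j N) (suc (suc m))) (coeff (U (suc j) N) m) ⟩
    coeff (U j N) (suc (suc m)) + coeff (U (suc j) N) m - coeff (U (suc j) N) m
      ≡⟨ cong₂ _-_ (trans (cong (coeff (U j N) (suc (suc m)) +_) (sym (coeff-X² (U (suc j) N) m))) (coeff≡ (U-split j N) (suc (suc m))))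
                   (coeff-U n (suc j) N) ⟩
    coeff (T j N) (suc (suc m)) - ∑ⁿ (suc n) f
      ≡⟨ cong₂ _+_ head≡ (trans (sym (∑ⁿ-neg (suc n) f)) (∑ⁿ-cong (suc n) tail≡)) ⟩
    ∑ⁿ (suc (suc n)) (λ i → sign i * coeff (T (j ℕ.+ i) N) (2 ℕ.* suc n ℕ.+ 1 ℕ.∸ 2 ℕ.* i)) ∎
    where
    open ≡-Reasoning
    open +-*-Solver
    m = 2 ℕ.* n ℕ.+ 1
    m≡ : 2 ℕ.* suc n ℕ.+ 1 ≡ suc (suc m)
    m≡ = cong (ℕ._+ 1) (ℕ.*-suc 2 n)
    f : ℕ → ℚ
    f i = sign i * coeff (T (suc j ℕ.+ i) N) (m ℕ.∸ 2 ℕ.* i)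
    head≡ : coeff (T j N) (suc (suc m)) ≡ 1ℚ * coeff (T (j ℕ.+ 0) N) (2 ℕ.* suc n ℕ.+ 1)
    head≡ = trans (cong₂ (λ i a → coeff (T i N) a) (sym (ℕ.+-identityʳ j)) (sym m≡)) (sym (ℚ.*-identityˡ _))
    tail≡ : ∀ i → - f i ≡ sign (suc i) * coeff (T (j ℕ.+ suc i) N) (2 ℕ.* suc n ℕ.+ 1 ℕ.∸ 2 ℕ.* suc i)
    tail≡ i = trans (sym (sign-suc i _)) (cong₂ (λ k a → sign (suc i) * coeff (T k N) a) (sym (ℕ.+-suc j i))
      (sym (cong₂ ℕ._∸_ m≡ (ℕ.*-suc 2 i))))

  -- Coefficients of the left-hand side

  ^⁻1 : ∀ k → suc k ^⁻ 1 ≡ u k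
  ^⁻1 k = trans (^⁻≡^ k 1) (ℚ.*-identityʳ (u k))

  coeff-⊛-geo : ∀ k f m → coeff (f ⊛ geo k) (suc m) ≡ coeff f (suc m) + u k * coeff (f ⊛ geo k) m
  coeff-⊛-geo k f m = trans (coeff≡ (⊛-comm f (geo k)) (suc m)) (trans (coeff-geo-⊛ k f m)
    (cong (λ a → coeff f (suc m) + u k * a) (coeff≡ (⊛-comm (geo k) f) m)))

  -- `P k` generates the complete homogeneous symmetric polynomials in 1, 1/2, ..., 1/k: either the
  -- index k + 1 is absent, or one copy of it is removed and more may follow.
  coeff-P : ∀ k p → coeff (P k) p ≡ nested id (replicate p 1) k
  coeff-P zero    zero    = refl
  coeff-P zero    (suc p) = refl
  coeff-P (suc k) zero    = trans (ℚ.*-identityʳ _) (coeff-P k 0)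
  coeff-P (suc k) (suc p) = trans (coeff-⊛-geo k (P k) p)
    (cong₂ _+_ (coeff-P k (suc p)) (cong₂ _*_ (sym (^⁻1 k)) (coeff-P (suc k) p)))

  -- The formal derivative of `P k`.
  P′ : ℕ → Powerseries
  coeff (P′ k) m = ι (m ℕ.+ 1) * coeff (P k) (suc m)

  -- The product rule for `P k ⊛ geo k`, the derivative of `geo k` being
  -- `const (u k) ⊛ geo k ⊛ geo k`. In the recursion of the coefficients the weight m + 1 is split:
  -- the part m gives `X ⊛ P′ (suc k)`, and `geo-unique` solves for `P′ (suc k)`.
  P′-suc : ∀ k → P′ (suc k) ≋ geo k ⊛ (P′ k ⊕ const (u k) ⊛ P (suc k))
  P′-suc k = geo-unique k (mk≋ λ m → begin
    ι (m ℕ.+ 1) * coeff (P (suc k)) (suc m)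
      ≡⟨ cong (ι (m ℕ.+ 1) *_) (coeff-⊛-geo k (P k) m) ⟩
    ι (m ℕ.+ 1) * (coeff (P k) (suc m) + u k * coeff (P (suc k)) m)
      ≡⟨ ℚ.*-distribˡ-+ (ι (m ℕ.+ 1)) _ _ ⟩
    ι (m ℕ.+ 1) * coeff (P k) (suc m) + ι (m ℕ.+ 1) * (u k * coeff (P (suc k)) m)
      ≡⟨ cong (λ a → ι (m ℕ.+ 1) * coeff (P k) (suc m) + a * (u k * coeff (P (suc k)) m)) (ι-+ m 1) ⟩
    ι (m ℕ.+ 1) * coeff (P k) (suc m) + (ι m + 1ℚ) * (u k * coeff (P (suc k)) m)
      ≡⟨ solve 4 (λ a n u x → a :+ (n :+ con 1ℚ) :* (u :* x) := a :+ u :* x :+ u :* (n :* x)) refl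
           (ι (m ℕ.+ 1) * coeff (P k) (suc m)) (ι m) (u k) (coeff (P (suc k)) m) ⟩
    ι (m ℕ.+ 1) * coeff (P k) (suc m) + u k * coeff (P (suc k)) m + u k * (ι m * coeff (P (suc k)) m)
      ≡⟨ cong₂ (λ a b → ι (m ℕ.+ 1) * coeff (P k) (suc m) + a + b) (sym (coeff-const (u k) (P (suc k)) m))
           (trans (cong (u k *_) (sym (shifted m))) (sym (coeff-const (u k) (X ⊛ P′ (suc k)) m))) ⟩
    coeff (P′ k ⊕ const (u k) ⊛ P (suc k) ⊕ const (u k) ⊛ (X ⊛ P′ (suc k))) m ∎)
    where
    open ≡-Reasoning
    open +-*-Solver
    shifted : ∀ m → coeff (X ⊛ P′ (suc k)) m ≡ ι m * coeff (P (suc k)) m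
    shifted zero    = trans (coeff-X (P′ (suc k)) 0) (sym (ℚ.*-zeroˡ (coeff (P (suc k)) 0)))
    shifted (suc m) = trans (coeff-X (P′ (suc k)) (suc m)) (cong (λ n → ι n * coeff (P (suc k)) (suc m)) (ℕ.+-comm m 1))

  -- Logarithmic differentiation. The sum of 1/(i - X) is written as `Λ k` plus its constant term
  -- `H k`, since the G-sums concern only the latter.
  P′≋ : ∀ k → P′ k ≋ P k ⊛ (Λ k ⊕ const (H k))
  P′≋ zero    = mk≋ λ
    { zero    → refl
    ; (suc m) → trans (ℚ.*-zeroʳ (ι (suc m ℕ.+ 1))) (sym (coeff-const 1ℚ (𝟘 ⊕ 𝟘) (suc m))) }
  P′≋ (suc k) = begin
    P′ (suc k) ≈⟨ P′-suc k ⟩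
    geo k ⊛ (P′ k ⊕ const (u k) ⊛ P (suc k)) ≈⟨ ≋.*-cong ≋.refl (≋.+-cong (P′≋ k) ≋.refl) ⟩
    geo k ⊛ (P k ⊛ (Λ k ⊕ h) ⊕ c ⊛ (P k ⊛ geo k))
      ≈⟨ solve 5 (λ q p l h c → q :* (p :* (l :+ h) :+ c :* (p :* q)) := p :* q :* (l :+ h :+ c :* q)) ≋.refl (geo k) (P k) (Λ k) h c ⟩
    P k ⊛ geo k ⊛ (Λ k ⊕ h ⊕ c ⊛ geo k) ≈⟨ ≋.*-cong ≋.refl (≋.+-cong ≋.refl (≋.*-cong ≋.refl (geo≋ k))) ⟩
    P k ⊛ geo k ⊛ (Λ k ⊕ h ⊕ c ⊛ (𝟙 ⊕ X ⊛ inv k))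
      ≈⟨ solve 7 (λ q p l h c x i → p :* q :* (l :+ h :+ c :* (con 1 :+ x :* i)) := p :* q :* (l :+ c :* (x :* i) :+ (h :+ c)))
           ≋.refl (geo k) (P k) (Λ k) h c X (inv k) ⟩
    P k ⊛ geo k ⊛ (Λ k ⊕ c ⊛ (X ⊛ inv k) ⊕ (h ⊕ c)) ≈⟨ ≋.*-cong ≋.refl (≋.+-cong ≋.refl (const-+ (H k) (u k))) ⟨
    P (suc k) ⊛ (Λ (suc k) ⊕ const (H (suc k))) ∎
    where
    open PowerseriesSolver
    open SetoidReasoning ≋.setoid
    h = const (H k)
    c = const (u k)

  powers : ℕ → Powerseries
  powers k = const (u k) ⊛ inv k

  coeff-powers : ∀ k q → coeff (powers k) q ≡ suc k ^⁻ (q ℕ.+ 2)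
  coeff-powers k q = trans (coeff-const (u k) (inv k) q) (trans (cong (u k *_) (coeff-const (u k) (geo k) q))
    (trans (sym (^⁻≡^ k (2 ℕ.+ q))) (cong (suc k ^⁻_) (ℕ.+-comm 2 q))))

  -- Of the `H (suc k)` in the logarithmic derivative, the inner index k₁ ≤ k of the G-sum accounts
  -- for `H k`. The remaining 1/(k+1) completes `Λ (suc k)` to `Λ k ⊕ inv k`.
  A-split : ∀ k → P′ (suc k) ⊛ powers k ≋ const (H k) ⊛ P (suc k) ⊛ powers k ⊕ A k
  A-split k = ≋.trans (≋.*-cong (≋.trans (P′-suc k) (≋.*-cong ≋.refl (≋.+-cong (P′≋ k) ≋.refl))) ≋.refl)
    (solve 5 (λ q p l h c → q :* (p :* (l :+ h) :+ c :* (p :* q)) :* (c :* (c :* q))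
        := h :* (p :* q) :* (c :* (c :* q)) :+ p :* (c :* q) :* (c :* q) :* (l :+ c :* q))
      ≋.refl (geo k) (P k) (Λ k) (const (H k)) (const (u k)))
    where open PowerseriesSolver

  nested-1 : ∀ N → nested pred [ 1 ] N ≡ H N
  nested-1 zero    = refl
  nested-1 (suc N) = cong₂ _+_ (nested-1 N) (trans (ℚ.*-identityʳ _) (^⁻1 N))

  reverse-replicate : ∀ n {a : ℕ} → reverse (replicate n a) ≡ replicate n a
  reverse-replicate zero        = refl
  reverse-replicate (suc n) {a} = trans (unfold-reverse a (replicate n a)) (trans (cong (_++ [ a ]) (reverse-replicate n)) (go n))
    where
    go : ∀ n → replicate n a ++ [ a ] ≡ a ∷ replicate n a
    go zero    = refl
    go (suc n) = cong (a ∷_) (go n)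

  ζ-part G-part : ℕ → ℕ → ℕ → ℚ
  ζ-part N p q = ι (p ℕ.+ 1) * nested id (reverse (replicate (p ℕ.+ 1) 1 ++ [ q ℕ.+ 2 ])) N
  G-part N p q = sumTo (G-term q 1 p) N

  ζ-part≡ : ∀ N p q → ζ-part N p q ≡ ι (p ℕ.+ 1) * nested id ((q ℕ.+ 2) ∷ replicate (suc p) 1) N
  ζ-part≡ N p q = cong (λ l → ι (p ℕ.+ 1) * nested id l N)
    (trans (reverse-++ (replicate (p ℕ.+ 1) 1) [ q ℕ.+ 2 ])
      (cong ((q ℕ.+ 2) ∷_) (trans (reverse-replicate (p ℕ.+ 1)) (cong (λ n → replicate n 1) (ℕ.+-comm p 1)))))

  ζ-part-suc : ∀ N p q → ζ-part (suc N) p q ≡ ζ-part N p q + coeff (P′ (suc N)) p * coeff (powers N) q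
  ζ-part-suc N p q = begin
    ζ-part (suc N) p q ≡⟨ ζ-part≡ (suc N) p q ⟩
    c * (z + suc N ^⁻ (q ℕ.+ 2) * x)
      ≡⟨ solve 4 (λ c z w x → c :* (z :+ w :* x) := c :* z :+ c :* x :* w) refl c z (suc N ^⁻ (q ℕ.+ 2)) x ⟩
    c * z + c * x * suc N ^⁻ (q ℕ.+ 2)
      ≡⟨ cong₂ _+_ (ζ-part≡ N p q) (cong₂ (λ a b → c * a * b) (coeff-P (suc N) (suc p)) (coeff-powers N q)) ⟨
    ζ-part N p q + c * coeff (P (suc N)) (suc p) * coeff (powers N) q ∎
    where
    open ≡-Reasoning
    open +-*-Solver
    c = ι (p ℕ.+ 1)
    z = nested id ((q ℕ.+ 2) ∷ replicate (suc p) 1) N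
    x = nested id (replicate (suc p) 1) (suc N)

  G-part-suc : ∀ N p q → G-part (suc N) p q ≡ G-part N p q + coeff (const (H N) ⊛ P (suc N)) p * coeff (powers N) q
  G-part-suc N p q = cong (G-part N p q +_) (trans (ℚ.*-comm (suc N ^⁻ (q ℕ.+ 2)) _)
    (sym (cong₂ _*_ (trans (coeff-const (H N) (P (suc N)) p) (cong₂ _*_ (sym (nested-1 N)) (coeff-P (suc N) p))) (coeff-powers N q))))

  coeff-∑A : ∀ N m → diag (ζ-part N) m ≡ diag (G-part N) m + coeff (∑< A N) m
  coeff-∑A zero m = begin
    diag (ζ-part 0) m ≡⟨ diag-cong (λ p q → trans (ζ-part≡ 0 p q) (ℚ.*-zeroʳ (ι (p ℕ.+ 1)))) m ⟩
    diag (λ _ _ → 0ℚ) m ≡⟨ ℚ.+-identityʳ _ ⟨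
    diag (λ _ _ → 0ℚ) m + 0ℚ ≡⟨ cong (diag (λ _ _ → 0ℚ) m +_) (coeff-𝟘 m) ⟨
    diag (λ _ _ → 0ℚ) m + coeff 𝟘 m ∎
    where open ≡-Reasoning
  coeff-∑A (suc N) m = begin
    diag (ζ-part (suc N)) m ≡⟨ diag-cong (ζ-part-suc N) m ⟩
    diag (λ p q → ζ-part N p q + coeff (P′ (suc N)) p * coeff (powers N) q) m ≡⟨ diag-+ (ζ-part N) _ m ⟩
    diag (ζ-part N) m + coeff (P′ (suc N) ⊛ powers N) m ≡⟨ cong₂ _+_ (coeff-∑A N m) (coeff≡ (A-split N) m) ⟩
    diag (G-part N) m + coeff (∑< A N) m + (h + coeff (A N) m)
      ≡⟨ solve 4 (λ g s h a → g :+ s :+ (h :+ a) := g :+ h :+ (s :+ a)) refl (diag (G-part N) m) (coeff (∑< A N) m) h (coeff (A N) m) ⟩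
    diag (G-part N) m + h + coeff (∑< A (suc N)) m
      ≡⟨ cong (_+ coeff (∑< A (suc N)) m) (trans (diag-cong (G-part-suc N) m) (diag-+ (G-part N) _ m)) ⟨
    diag (G-part (suc N)) m + coeff (∑< A (suc N)) m ∎
    where
    open ≡-Reasoning
    open +-*-Solver
    h = coeff (const (H N) ⊛ P (suc N) ⊛ powers N) m

  -- Nonnegativity of the coefficients

  NonNegative : Powerseries → Set
  NonNegative f = ∀ m → 0ℚ ≤ coeff f m

  ⊕-nonNegative : ∀ {f g} → NonNegative f → NonNegative g → NonNegative (f ⊕ g)
  ⊕-nonNegative hf hg m = 0≤+ (hf m) (hg m)

  ⊛-nonNegative : ∀ {f g} → NonNegative f → NonNegative g → NonNegative (f ⊛ g)
  ⊛-nonNegative hf hg = 0≤diag (λ p q → 0≤* (hf p) (hg q))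

  const-nonNegative : ∀ {c} → 0ℚ ≤ c → NonNegative (const c)
  const-nonNegative h zero    = h
  const-nonNegative h (suc m) = ℚ.≤-refl

  X-nonNegative : NonNegative X
  X-nonNegative zero          = ℚ.≤-refl
  X-nonNegative (suc zero)    = 0≤1
  X-nonNegative (suc (suc m)) = ℚ.≤-refl

  geo-nonNegative : ∀ k → NonNegative (geo k)
  geo-nonNegative k = 0≤^ (0≤u k)

  inv-nonNegative : ∀ k → NonNegative (inv k)
  inv-nonNegative k = ⊛-nonNegative {const (u k)} {geo k} (const-nonNegative (0≤u k)) (geo-nonNegative k)

  P-nonNegative : ∀ k → NonNegative (P k)
  P-nonNegative zero    = const-nonNegative 0≤1
  P-nonNegative (suc k) = ⊛-nonNegative {P k} {geo k} (P-nonNegative k) (geo-nonNegative k)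

  Λ-nonNegative : ∀ k → NonNegative (Λ k)
  Λ-nonNegative zero    = const-nonNegative ℚ.≤-refl
  Λ-nonNegative (suc k) = ⊕-nonNegative {Λ k} {const (u k) ⊛ (X ⊛ inv k)} (Λ-nonNegative k)
    (⊛-nonNegative {const (u k)} {X ⊛ inv k} (const-nonNegative (0≤u k))
      (⊛-nonNegative {X} {inv k} X-nonNegative (inv-nonNegative k)))

  A-nonNegative : ∀ k → NonNegative (A k)
  A-nonNegative k = ⊛-nonNegative {P k ⊛ inv k ⊛ inv k} {Λ k ⊕ inv k}
    (⊛-nonNegative {P k ⊛ inv k} {inv k} (⊛-nonNegative {P k} {inv k} (P-nonNegative k) (inv-nonNegative k)) (inv-nonNegative k))
    (⊕-nonNegative {Λ k} {inv k} (Λ-nonNegative k) (inv-nonNegative k))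

  cutoff-nonNegative : ∀ N k → NonNegative (cutoff N k)
  cutoff-nonNegative N       zero    = const-nonNegative 0≤1
  cutoff-nonNegative zero    (suc k) = const-nonNegative ℚ.≤-refl
  cutoff-nonNegative (suc N) (suc k) = ⊛-nonNegative {geo N} {cutoff N k} (geo-nonNegative N) (cutoff-nonNegative N k)

  -- Estimates for removing the cutoff

  ^-monoʳ : ∀ {h} → 1ℚ ≤ h → ∀ {r s} → r ℕ.≤ s → h ^ℚ r ≤ h ^ℚ s
  ^-monoʳ 1≤h {s = zero}  z≤n = ℚ.≤-refl
  ^-monoʳ {h} 1≤h {s = suc s} z≤n = ℚ.≤-trans (^-monoʳ 1≤h {s = s} z≤n)
    (subst (_≤ h * h ^ℚ s) (ℚ.*-identityˡ (h ^ℚ s)) (*-monoʳ (0≤^ (ℚ.≤-trans 0≤1 1≤h) s) 1≤h))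
  ^-monoʳ 1≤h (s≤s le) = *-monoˡ (ℚ.≤-trans 0≤1 1≤h) (^-monoʳ 1≤h le)

  ^-distrib-* : ∀ a b r → (a * b) ^ℚ r ≡ a ^ℚ r * b ^ℚ r
  ^-distrib-* a b zero    = refl
  ^-distrib-* a b (suc r) = trans (cong (a * b *_) (^-distrib-* a b r))
    (solve 4 (λ a b c d → a :* b :* (c :* d) := a :* c :* (b :* d)) refl a b (a ^ℚ r) (b ^ℚ r))
    where open +-*-Solver

  cutoff-head : ∀ N k → k ℕ.≤ N → coeff (cutoff N k) 0 ≡ 1ℚ
  cutoff-head N       zero    le       = refl
  cutoff-head (suc N) (suc k) (s≤s le) = trans (ℚ.*-identityˡ _) (cutoff-head N k le)

  -- The coefficients are complete homogeneous polynomials in some of the reciprocals 1, ..., 1/N,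
  -- hence at most a power of their full sum.
  cutoff≤H^ : ∀ N k r → coeff (cutoff N k) r ≤ H N ^ℚ r
  cutoff≤H^ N       zero    zero    = ℚ.≤-refl
  cutoff≤H^ N       zero    (suc r) = 0≤^ (0≤H N) (suc r)
  cutoff≤H^ zero    (suc k) zero    = 0≤1
  cutoff≤H^ zero    (suc k) (suc r) = 0≤^ (0≤H zero) (suc r)
  cutoff≤H^ (suc N) (suc k) zero    = subst (_≤ 1ℚ) (sym (ℚ.*-identityˡ _)) (cutoff≤H^ N k 0)
  cutoff≤H^ (suc N) (suc k) (suc r) = begin
    coeff (geo N ⊛ cutoff N k) (suc r) ≡⟨ coeff-geo-⊛ N (cutoff N k) r ⟩
    coeff (cutoff N k) (suc r) + u N * coeff (geo N ⊛ cutoff N k) r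
      ≤⟨ ℚ.+-mono-≤ (cutoff≤H^ N k (suc r)) (*-monoˡ (0≤u N) (cutoff≤H^ (suc N) (suc k) r)) ⟩
    H N * H N ^ℚ r + u N * H (suc N) ^ℚ r
      ≤⟨ ℚ.+-monoˡ-≤ (u N * H (suc N) ^ℚ r) (*-monoˡ (0≤H N) (^-mono (0≤H N) (H-mono (ℕ.n≤1+n N)) r)) ⟩
    H N * H (suc N) ^ℚ r + u N * H (suc N) ^ℚ r ≡⟨ ℚ.*-distribʳ-+ (H (suc N) ^ℚ r) (H N) (u N) ⟨
    H (suc N) ^ℚ suc r ∎
    where open ℚ.≤-Reasoning

  -- Taking off the factor `geo N` lowers N and k together. As (N+1) `u N` = 1, this costs at most
  -- H^(r+1) + H^r = (1 + H) H^r with H = `H (suc N)`, whence the condition on h; after k steps the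
  -- cost is k h^(r+1).
  N*cutoff≤ : ∀ N k r {h} → 1ℚ + H N ≤ h → ι N * coeff (cutoff N k) (suc r) ≤ ι k * h ^ℚ suc r
  N*cutoff≤ N       zero    r {h} le = ℚ.≤-reflexive (trans (ℚ.*-zeroʳ (ι N)) (sym (ℚ.*-zeroˡ (h ^ℚ suc r))))
  N*cutoff≤ zero    (suc k) r {h} le = 0≤* (0≤ι (suc k)) (0≤^ (ℚ.≤-trans (0≤+ 0≤1 (0≤H 0)) le) (suc r))
  N*cutoff≤ (suc N) (suc k) r {h} le = begin
    ι (suc N) * coeff (geo N ⊛ cutoff N k) (suc r) ≡⟨ cong (ι (suc N) *_) (coeff-geo-⊛ N (cutoff N k) r) ⟩
    ι (suc N) * (x + u N * y′)
      ≡⟨ solve 4 (λ n x u y → n :* (x :+ u :* y) := n :* x :+ n :* u :* y) refl (ι (suc N)) x (u N) y′ ⟩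
    ι (suc N) * x + ι (suc N) * u N * y′ ≡⟨ cong₂ (λ a b → a * x + b * y′) (ι-+ 1 N) (u-inv N) ⟩
    (1ℚ + ι N) * x + 1ℚ * y′
      ≡⟨ solve 3 (λ n x y → (con 1ℚ :+ n) :* x :+ con 1ℚ :* y := n :* x :+ (x :+ y)) refl (ι N) x y′ ⟩
    ι N * x + (x + y′)
      ≤⟨ ℚ.+-mono-≤ (N*cutoff≤ N k r (ℚ.≤-trans (ℚ.+-monoʳ-≤ 1ℚ (H-mono (ℕ.n≤1+n N))) le)) x+y≤ ⟩
    ι k * h ^ℚ suc r + h ^ℚ suc r
      ≡⟨ solve 2 (λ k a → k :* a :+ a := (con 1ℚ :+ k) :* a) refl (ι k) (h ^ℚ suc r) ⟩
    (1ℚ + ι k) * h ^ℚ suc r ≡⟨ cong (_* h ^ℚ suc r) (ι-+ 1 k) ⟨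
    ι (suc k) * h ^ℚ suc r ∎
    where
    open ℚ.≤-Reasoning
    open +-*-Solver
    x  = coeff (cutoff N k) (suc r)
    y′ = coeff (cutoff (suc N) (suc k)) r
    H≤h : H (suc N) ≤ h
    H≤h = ℚ.≤-trans (subst (_≤ 1ℚ + H (suc N)) (ℚ.+-identityˡ _) (ℚ.+-monoˡ-≤ (H (suc N)) 0≤1)) le
    x+y≤ : x + y′ ≤ h ^ℚ suc r
    x+y≤ = begin
      x + y′
        ≤⟨ ℚ.+-mono-≤ (ℚ.≤-trans (cutoff≤H^ N k (suc r)) (^-mono (0≤H N) (H-mono (ℕ.n≤1+n N)) (suc r)))
                      (cutoff≤H^ (suc N) (suc k) r) ⟩
      H (suc N) * H (suc N) ^ℚ r + H (suc N) ^ℚ r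
        ≡⟨ solve 2 (λ h a → h :* a :+ a := (con 1ℚ :+ h) :* a) refl (H (suc N)) (H (suc N) ^ℚ r) ⟩
      (1ℚ + H (suc N)) * H (suc N) ^ℚ r
        ≤⟨ *-mono (0≤^ (0≤H (suc N)) r) (ℚ.≤-trans (0≤H (suc N)) H≤h) le (^-mono (0≤H (suc N)) H≤h r) ⟩
      h ^ℚ suc r ∎

  -- `A-split` exhibits `A k` as one of two nonnegative parts of `P′ (suc k) ⊛ powers k`, whose
  -- coefficients are explicit.
  A≤ : ∀ k p {h} → 1ℚ ≤ h → H (suc k) ≤ h →
    coeff (A k) p ≤ ι (suc p) * (ι (suc p) * h ^ℚ suc p * (u k * u k))
  A≤ k p {h} 1≤h H≤h = begin
    coeff (A k) p ≡⟨ ℚ.+-identityˡ _ ⟨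
    0ℚ + coeff (A k) p
      ≤⟨ ℚ.+-monoˡ-≤ (coeff (A k) p) (⊛-nonNegative {const (H k) ⊛ P (suc k)} {powers k}
           (⊛-nonNegative {const (H k)} {P (suc k)} (const-nonNegative (0≤H k)) (P-nonNegative (suc k)))
           (⊛-nonNegative {const (u k)} {inv k} (const-nonNegative (0≤u k)) (inv-nonNegative k)) p) ⟩
    coeff (const (H k) ⊛ P (suc k) ⊛ powers k) p + coeff (A k) p ≡⟨ coeff≡ (A-split k) p ⟨
    coeff (P′ (suc k) ⊛ powers k) p ≤⟨ diag≤ _ _ p bound ⟩
    ι (suc p) * (ι (suc p) * h ^ℚ suc p * (u k * u k)) ∎
    where
    open ℚ.≤-Reasoning
    0≤h = ℚ.≤-trans 0≤1 1≤h
    P≤ : ∀ r → coeff (P (suc k)) r ≤ H (suc k) ^ℚ r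
    P≤ r = subst₂ _≤_ (sym (coeff-P (suc k) r)) (cong (H (suc k) ^ℚ_) (length-replicate r))
      (nested≤H^ id (λ _ → ℕ.≤-refl) (replicate⁺ r ℕ.≤-refl) (suc k))
    bound : ∀ i q → i ℕ.+ q ≡ p → coeff (P′ (suc k)) i * coeff (powers k) q ≤ ι (suc p) * h ^ℚ suc p * (u k * u k)
    bound i q refl = *-mono
      (subst (0ℚ ≤_) (sym (coeff-powers k q)) (0≤^⁻ (suc k) (q ℕ.+ 2)))
      (0≤* (0≤ι (suc p)) (0≤^ 0≤h (suc p)))
      (*-mono (P-nonNegative (suc k) (suc i)) (0≤ι (suc p))
        (ι-mono (i ℕ.+ 1) (suc p) (subst (ℕ._≤ suc p) (ℕ.+-comm 1 i) (s≤s (ℕ.m≤m+n i q))))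
        (ℚ.≤-trans (P≤ (suc i)) (ℚ.≤-trans (^-mono (0≤H (suc k)) H≤h (suc i)) (^-monoʳ 1≤h (s≤s (ℕ.m≤m+n i q))))))
      (subst (_≤ u k * u k) (sym (coeff-powers k q)) (^⁻≤u² k (ℕ.m≤n+m 2 q)))

  head≤diag : ∀ F m → (∀ p q → 0ℚ ≤ F p q) → F m 0 ≤ diag F m
  head≤diag F zero    h = ℚ.≤-refl
  head≤diag F (suc m) h = subst₂ _≤_ (ℚ.+-identityˡ _) (sym (diag-suc F m))
    (ℚ.+-monoˡ-≤ (F (suc m) 0) (0≤diag (λ p q → h p (suc q)) m))

  -- Applied to `A k ⊛ cutoff N (suc k)`: the entry F m 0 pairs with the constant term 1 of the
  -- cutoff and is the wanted coefficient; the other m entries are the error.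
  diag≤head : ∀ F B m → (∀ p r → p ℕ.+ suc r ≡ m → F p (suc r) ≤ B) → diag F m ≤ ι m * B + F m 0
  diag≤head F B zero    h = ℚ.≤-reflexive (solve 2 (λ f b → f := con 0ℚ :* b :+ f) refl (F 0 0) B)
    where open +-*-Solver
  diag≤head F B (suc m) h = subst (_≤ ι (suc m) * B + F (suc m) 0) (sym (diag-suc F m))
    (ℚ.+-monoˡ-≤ (F (suc m) 0) (diag≤ (λ p q → F p (suc q)) B m (λ p r eq → h p r (trans (ℕ.+-suc p r) (cong suc eq)))))

  module Error (M m : ℕ) {h : ℚ} (1≤h : 1ℚ ≤ h) (1+H≤h : 1ℚ + H (suc M) ≤ h) where

    N = suc M
    c = ι (suc m) * ι (suc m) * (h * h ^ℚ suc m) * u M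

    0≤h : 0ℚ ≤ h
    0≤h = ℚ.≤-trans 0≤1 1≤h

    H≤h : H N ≤ h
    H≤h = ℚ.≤-trans (subst (_≤ 1ℚ + H N) (ℚ.+-identityˡ _) (ℚ.+-monoˡ-≤ (H N) 0≤1)) 1+H≤h

    cutoff≤ : ∀ k r → coeff (cutoff N k) (suc r) ≤ u M * (ι k * h ^ℚ suc r)
    cutoff≤ k r = begin
      z ≡⟨ trans (cong (_* z) (u-inv M)) (ℚ.*-identityˡ z) ⟨
      ι N * u M * z ≡⟨ solve 3 (λ n u z → n :* u :* z := u :* (n :* z)) refl (ι N) (u M) z ⟩
      u M * (ι N * z) ≤⟨ *-monoˡ (0≤u M) (N*cutoff≤ N k r 1+H≤h) ⟩
      u M * (ι k * h ^ℚ suc r) ∎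
      where
      open ℚ.≤-Reasoning
      open +-*-Solver
      z = coeff (cutoff N k) (suc r)

    lower : ∀ k → k ℕ.< N → coeff (A k) m ≤ coeff (A k ⊛ cutoff N (suc k)) m
    lower k k<N = subst (_≤ coeff (A k ⊛ cutoff N (suc k)) m)
      (trans (cong (coeff (A k) m *_) (cutoff-head N (suc k) k<N)) (ℚ.*-identityʳ _))
      (head≤diag _ m (λ p q → 0≤* (A-nonNegative k p) (cutoff-nonNegative N (suc k) q)))

    upper : ∀ k → k ℕ.< N → coeff (A k ⊛ cutoff N (suc k)) m ≤ ι m * (c * u k) + coeff (A k) m
    upper k k<N = subst (λ a → coeff (A k ⊛ cutoff N (suc k)) m ≤ ι m * (c * u k) + a)
      (trans (cong (coeff (A k) m *_) (cutoff-head N (suc k) k<N)) (ℚ.*-identityʳ _))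
      (diag≤head _ (c * u k) m bound)
      where
      open ℚ.≤-Reasoning
      open +-*-Solver
      bound : ∀ p r → p ℕ.+ suc r ≡ m → coeff (A k) p * coeff (cutoff N (suc k)) (suc r) ≤ c * u k
      bound p r eq = begin
        coeff (A k) p * coeff (cutoff N (suc k)) (suc r)
          ≤⟨ *-mono (cutoff-nonNegative N (suc k) (suc r))
               (0≤* (0≤ι (suc p)) (0≤* (0≤* (0≤ι (suc p)) (0≤^ 0≤h (suc p))) (0≤* (0≤u k) (0≤u k))))
               (A≤ k p 1≤h (ℚ.≤-trans (H-mono k<N) H≤h)) (cutoff≤ (suc k) r) ⟩
        ι (suc p) * (ι (suc p) * h ^ℚ suc p * (u k * u k)) * (u M * (ι (suc k) * h ^ℚ suc r))
          ≡⟨ solve 6 (λ p a u m k b → p :* (p :* a :* (u :* u)) :* (m :* (k :* b)) := p :* p :* ((a :* b) :* (m :* (u :* (k :* u)))))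
               refl (ι (suc p)) (h ^ℚ suc p) (u k) (u M) (ι (suc k)) (h ^ℚ suc r) ⟩
        -- One factor `u k` from `A≤` cancels the k + 1 from `cutoff≤`; the other is kept, to be
        -- summed over k to a harmonic number.
        ι (suc p) * ι (suc p) * ((h ^ℚ suc p * h ^ℚ suc r) * (u M * (u k * (ι (suc k) * u k))))
          ≡⟨ cong₂ (λ a b → ι (suc p) * ι (suc p) * (a * (u M * (u k * b))))
               (trans (sym (^-+ h (suc p) (suc r))) (cong (λ i → h ^ℚ suc i) eq)) (u-inv k) ⟩
        ι (suc p) * ι (suc p) * (h ^ℚ suc m * (u M * (u k * 1ℚ)))
          ≤⟨ *-mono (0≤* (0≤^ 0≤h (suc m)) (0≤* (0≤u M) (0≤* (0≤u k) 0≤1))) (0≤* (0≤ι (suc m)) (0≤ι (suc m)))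
               (*-mono (0≤ι (suc p)) (0≤ι (suc m)) p≤m p≤m)
               (*-monoʳ (0≤* (0≤u M) (0≤* (0≤u k) 0≤1)) (^-monoʳ 1≤h (ℕ.n≤1+n (suc m)))) ⟩
        ι (suc m) * ι (suc m) * (h * h ^ℚ suc m * (u M * (u k * 1ℚ)))
          ≡⟨ solve 4 (λ m a x y → m :* m :* (a :* (x :* (y :* con 1ℚ))) := m :* m :* a :* x :* y)
               refl (ι (suc m)) (h * h ^ℚ suc m) (u M) (u k) ⟩
        c * u k ∎
        where
        p≤m : ι (suc p) ≤ ι (suc m)
        p≤m = ι-mono (suc p) (suc m) (s≤s (subst (p ℕ.≤_) eq (ℕ.m≤m+n p (suc r))))

    ∑lower : ∀ n → n ℕ.≤ N → coeff (∑< A n) m ≤ coeff (∑< (λ k → A k ⊛ cutoff N (suc k)) n) m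
    ∑lower zero    le = ℚ.≤-refl
    ∑lower (suc n) le = ℚ.+-mono-≤ (∑lower n (ℕ.<⇒≤ le)) (lower n le)

    ∑upper : ∀ n → n ℕ.≤ N → coeff (∑< (λ k → A k ⊛ cutoff N (suc k)) n) m ≤ ι m * (c * H n) + coeff (∑< A n) m
    ∑upper zero    le = ℚ.≤-reflexive (solve 3 (λ m c s → s := m :* (c :* con 0ℚ) :+ s) refl (ι m) c (coeff 𝟘 m))
      where open +-*-Solver
    ∑upper (suc n) le = begin
      coeff (∑< (λ k → A k ⊛ cutoff N (suc k)) n) m + coeff (A n ⊛ cutoff N (suc n)) m
        ≤⟨ ℚ.+-mono-≤ (∑upper n (ℕ.<⇒≤ le)) (upper n le) ⟩
      ι m * (c * H n) + coeff (∑< A n) m + (ι m * (c * u n) + coeff (A n) m)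
        ≡⟨ solve 6 (λ m c h s u a → m :* (c :* h) :+ s :+ (m :* (c :* u) :+ a) := m :* (c :* (h :+ u)) :+ (s :+ a))
             refl (ι m) c (H n) (coeff (∑< A n) m) (u n) (coeff (A n) m) ⟩
      ι m * (c * H (suc n)) + coeff (∑< A (suc n)) m ∎
      where
      open ℚ.≤-Reasoning
      open +-*-Solver

  -- With h = 2 H_N, the error is at most a constant times h^(m+3)/N. The power of 2 is split off,
  -- and `H^≤` replaces H_N^(m+3) by `ι (bd (3 ℕ.+ m))` times `y M`, where `u M * y M` is `e M`.
  errorConstant : ℕ → ℚ
  errorConstant m = ι m * (ι (suc m) * ι (suc m)) * (ι 2 ^ℚ (3 ℕ.+ m) * ι (bd (3 ℕ.+ m)))

  0≤errorConstant : ∀ m → 0ℚ ≤ errorConstant m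
  0≤errorConstant m = 0≤* (0≤* (0≤ι m) (0≤* (0≤ι (suc m)) (0≤ι (suc m)))) (0≤* (0≤^ (0≤ι 2) (3 ℕ.+ m)) (0≤ι (bd (3 ℕ.+ m))))

  1≤H : ∀ M → 1ℚ ≤ H (suc M)
  1≤H M = H-mono {1} {suc M} (s≤s z≤n)

  H≤2H : ∀ M → H (suc M) ≤ ι 2 * H (suc M)
  H≤2H M = subst (_≤ ι 2 * H (suc M)) (ℚ.*-identityˡ _) (*-monoʳ (0≤H (suc M)) (ι-mono 1 2 (s≤s z≤n)))

  1+H≤2H : ∀ M → 1ℚ + H (suc M) ≤ ι 2 * H (suc M)
  1+H≤2H M = subst (1ℚ + H (suc M) ≤_) (solve 1 (λ h → h :+ h := con (ι 2) :* h) refl (H (suc M)))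
    (ℚ.+-monoˡ-≤ (H (suc M)) (1≤H M))
    where open +-*-Solver

  module _ (M m : ℕ) where

    private
      N = suc M
      -- At least 1 + H_N because H_N ≥ 1, and a multiple of H_N, so that `H^≤` applies to its
      -- powers.
      h = ι 2 * H N
      open Error M m {h} (ℚ.≤-trans (1≤H M) (H≤2H M)) (1+H≤2H M) using (c; 0≤h; H≤h; ∑lower; ∑upper)

    error≤ : ι m * (c * H N) ≤ errorConstant m * e M
    error≤ = begin
      ι m * (s * s * (h * h ^ℚ suc m) * u M * H N)
        ≡⟨ solve 5 (λ m s a u x → m :* (s :* s :* a :* u :* x) := m :* (s :* s) :* (u :* (x :* a))) refl (ι m) s (h * h ^ℚ suc m) (u M) (H N) ⟩
      ι m * (s * s) * (u M * (H N * h ^ℚ (2 ℕ.+ m)))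
        ≤⟨ *-monoˡ 0≤ms² (*-monoˡ (0≤u M) (*-monoʳ (0≤^ 0≤h (2 ℕ.+ m)) H≤h)) ⟩
      ι m * (s * s) * (u M * h ^ℚ (3 ℕ.+ m))
        ≡⟨ cong (λ a → ι m * (s * s) * (u M * a)) (^-distrib-* (ι 2) (H N) (3 ℕ.+ m)) ⟩
      ι m * (s * s) * (u M * (ι 2 ^ℚ (3 ℕ.+ m) * H N ^ℚ (3 ℕ.+ m)))
        ≤⟨ *-monoˡ 0≤ms² (*-monoˡ (0≤u M) (*-monoˡ (0≤^ (0≤ι 2) (3 ℕ.+ m)) (H^≤ (3 ℕ.+ m) M))) ⟩
      ι m * (s * s) * (u M * (ι 2 ^ℚ (3 ℕ.+ m) * (ι (bd (3 ℕ.+ m)) * y M)))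
        ≡⟨ solve 5 (λ a u p b y → a :* (u :* (p :* (b :* y))) := a :* (p :* b) :* (u :* y)) refl
             (ι m * (s * s)) (u M) (ι 2 ^ℚ (3 ℕ.+ m)) (ι (bd (3 ℕ.+ m))) (y M) ⟩
      errorConstant m * (u M * y M) ≡⟨ cong (errorConstant m *_) (u*y M) ⟩
      errorConstant m * e M ∎
      where
      open ℚ.≤-Reasoning
      open +-*-Solver
      s = ι (suc m)
      0≤ms² = 0≤* (0≤ι m) (0≤* (0≤ι (suc m)) (0≤ι (suc m)))

    ∣∑A-S∣≤ : ∣ coeff (∑< A N) m - coeff (S N) m ∣ ≤ errorConstant m * e M
    ∣∑A-S∣≤ = begin
      ∣ coeff (∑< A N) m - coeff (S N) m ∣ ≡⟨ ∣-∣-swap (coeff (∑< A N) m) (coeff (S N) m) ⟩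
      ∣ coeff (S N) m - coeff (∑< A N) m ∣ ≡⟨ ℚ.0≤p⇒∣p∣≡p (p≤q⇒0≤q-p (∑lower N ℕ.≤-refl)) ⟩
      coeff (S N) m - coeff (∑< A N) m
        ≤⟨ p≤q+r⇒p-q≤r (subst (coeff (S N) m ≤_) (ℚ.+-comm (ι m * (c * H N)) _) (∑upper N ℕ.≤-refl)) ⟩
      ι m * (c * H N) ≤⟨ error≤ ⟩
      errorConstant m * e M ∎
      where open ℚ.≤-Reasoning

  ≈-of-coeff : ∀ {x y} m → (∀ N → seq x N ≡ coeff (∑< A N) m) → (∀ N → seq y N ≡ coeff (S N) m) → x ≈ y
  ≈-of-coeff {x} {y′} m x≡ y≡ ε 0<ε =
    let (M , Ke<ε) = e→0 (errorConstant m) (0≤errorConstant m) ε 0<ε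
    -- The bound for the approximation number n + 1 is in terms of `e n`, hence the shift by one.
    in suc M , λ n M<n → bound M Ke<ε n M<n
    where
    open ℚ.≤-Reasoning
    bound : ∀ M → errorConstant m * e M < ε → ∀ n → M ℕ.< n → ∣ seq x n - seq y′ n ∣ < ε
    bound M Ke<ε (suc n) (s≤s M≤n) = begin-strict
      ∣ seq x (suc n) - seq y′ (suc n) ∣ ≡⟨ cong₂ (λ a b → ∣ a - b ∣) (x≡ (suc n)) (y≡ (suc n)) ⟩
      ∣ coeff (∑< A (suc n)) m - coeff (S (suc n)) m ∣ ≤⟨ ∣∑A-S∣≤ n m ⟩
      errorConstant m * e n ≤⟨ *-monoˡ {errorConstant m} {e n} {e M} (0≤errorConstant m) (e-anti {M} {n} M≤n) ⟩
      errorConstant m * e M <⟨ Ke<ε ⟩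
      ε ∎

  -- The approximations of both sides as coefficients

  ζ★-summand G-summand : ℕ × ℕ → ℝ
  ζ★-summand (p , q) = ℤ.+ (p ℕ.+ 1) · ζ★ (replicate (p ℕ.+ 1) 1 ++ [ q ℕ.+ 2 ]) (ones-admissible (p ℕ.+ 1) (ℕ.m≤n+m 2 q))
  G-summand (p , q) = G[ q +2] 1 p

  ζ-summand : ∀ {j} → Vec ℕ (suc j) → ℝ
  ζ-summand c = ℤ.+ W c · ζ (shift c) (shift-admissible c)

  lhs : ℕ → ℝ
  lhs m = ∑ (splits m) ζ★-summand -ᵣ ∑ (splits m) G-summand

  seq-lhs : ∀ m N → seq (lhs m) N ≡ coeff (∑< A N) m
  seq-lhs m N = begin
    seq (∑ (splits m) ζ★-summand) N + - 1ℚ * seq (∑ (splits m) G-summand) N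
      ≡⟨ cong₂ (λ a b → a + - 1ℚ * b)
           (trans (seq-∑ (splits m) ζ★-summand N) (∑ˡ-splits m (λ a → seq (ζ★-summand a) N)))
           (trans (seq-∑ (splits m) G-summand N) (∑ˡ-splits m (λ a → seq (G-summand a) N))) ⟩
    diag (ζ-part N) m + - 1ℚ * diag (G-part N) m ≡⟨ cong (_+ - 1ℚ * diag (G-part N) m) (coeff-∑A N m) ⟩
    diag (G-part N) m + coeff (∑< A N) m + - 1ℚ * diag (G-part N) m
      ≡⟨ solve 2 (λ g s → g :+ s :+ con (- 1ℚ) :* g := s) refl (diag (G-part N) m) (coeff (∑< A N) m) ⟩
    coeff (∑< A N) m ∎
    where
    open ≡-Reasoning
    open +-*-Solver

  signed-summand : ℕ → ℕ → ℝ
  signed-summand n j = -1ℤ ℤ.^ j · ∑ (tuples (suc j) (2 ℕ.* n ℕ.+ 1 ℕ.∸ 2 ℕ.* j)) ζ-summand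

  rhs : ℕ → ℝ
  rhs n = ℤ.+ ((2 ℕ.* n ℕ.+ 4) C 3) · ζ [ 2 ℕ.* n ℕ.+ 4 ] (2n+4-admissible n) +ᵣ ∑ (applyUpTo suc n) (signed-summand n)

  seq-rhs : ∀ n N → seq (rhs n) N ≡ coeff (S N) (2 ℕ.* n ℕ.+ 1)
  seq-rhs n N = trans (cong₂ _+_ first rest) (sym (coeff-U n 0 N))
    where
    open ≡-Reasoning
    m = 2 ℕ.* n ℕ.+ 1
    first : ι ((2 ℕ.* n ℕ.+ 4) C 3) * nested pred [ 2 ℕ.* n ℕ.+ 4 ] N ≡ 1ℚ * coeff (T 0 N) m
    first = sym (trans (ℚ.*-identityˡ _) (trans (coeff-T 0 N m) (trans (summand₀ N m)
      (cong (λ a → ι (a C 3) * nested pred [ a ] N) (ℕ.+-assoc (2 ℕ.* n) 1 3)))))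
    rest : seq (∑ (applyUpTo suc n) (signed-summand n)) N ≡
      ∑ⁿ n (λ i → sign (suc i) * coeff (T (suc i) N) (m ℕ.∸ 2 ℕ.* suc i))
    rest = begin
      seq (∑ (applyUpTo suc n) (signed-summand n)) N ≡⟨ seq-∑ (applyUpTo suc n) (signed-summand n) N ⟩
      ∑ˡ (applyUpTo suc n) (λ j → seq (signed-summand n j) N) ≡⟨ ∑ˡ-applyUpTo suc n (λ j → seq (signed-summand n j) N) ⟩
      ∑ⁿ n (λ i → sign (suc i) * seq (∑ (tuples (suc (suc i)) (m ℕ.∸ 2 ℕ.* suc i)) ζ-summand) N)
        ≡⟨ ∑ⁿ-cong n (λ i → cong (sign (suc i) *_) (trans
             (seq-∑ (tuples (suc (suc i)) (m ℕ.∸ 2 ℕ.* suc i)) ζ-summand N)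
             (sym (coeff-T (suc i) N (m ℕ.∸ 2 ℕ.* suc i))))) ⟩
      ∑ⁿ n (λ i → sign (suc i) * coeff (T (suc i) N) (m ℕ.∸ 2 ℕ.* suc i)) ∎

open Approximation using (≈-of-coeff; lhs; rhs; seq-lhs; seq-rhs)
open import Data.Integer using (+_; -1ℤ; _^_)
open import Data.List using ([_]; _++_; applyUpTo; replicate)
open import Data.Nat using (ℕ; suc; _+_; _*_; _∸_)
open import Data.Nat.Combinatorics using (_C_)
open import Data.Nat.Properties using (m≤n+m)
open import Data.Product using (_,_)

theorem5p3 : (n : ℕ) →
    ∑ (splits (2 * n + 1)) (λ (p , q) → + (p + 1) · ζ★ (replicate (p + 1) 1 ++ [ q + 2 ]) (ones-admissible (p + 1) (m≤n+m 2 q)))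
    -ᵣ ∑ (splits (2 * n + 1)) (λ (p , q) → G[ q +2] 1 p)
    ≈ + ((2 * n + 4) C 3) · ζ [ 2 * n + 4 ] (2n+4-admissible n)
    +ᵣ ∑ (applyUpTo suc n) (λ j → -1ℤ ^ j · ∑ (tuples (suc j) (2 * n + 1 ∸ 2 * j)) (λ c → + W c · ζ (shift c) (shift-admissible c)))
theorem5p3 n = ≈-of-coeff {lhs (2 * n + 1)} {rhs n} (2 * n + 1) (seq-lhs (2 * n + 1)) (seq-rhs n)
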